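{- Let $H\subseteq \operatorname{GL}_2(\hat{\mathbb{Z}})$ be a closed subgroup. Then $H=\operatorname{GL}_2(\hat{\mathbb{Z}})$ if and only if (i) $\pi_\ell(H)=\operatorname{GL}_2(\mathbb{Z}_\ell)$ for every prime $\ell$, and (ii) the map $(\operatorname{sgn},\det)\colon H\rightarrow \{\pm 1\}\times\hat{\mathbb{Z}}^{*}$ is surjective.
   Context: $\hat{\mathbb{Z}}=\varprojlim \mathbb{Z}/m\mathbb{Z}\simeq\prod_{\ell \text{ prime}}\mathbb{Z}_\ell$, so $\operatorname{GL}_2(\hat{\mathbb{Z}})\simeq\prod_{\ell}\operatorname{GL}_2(\mathbb{Z}_\ell)$ (a profinite group); $\pi_\ell\colon \operatorname{GL}_2(\hat{\mathbb{Z}})\to\operatorname{GL}_2(\mathbb{Z}_\ell)$ is the projection. The map $\operatorname{sgn}\colon\operatorname{GL}_2(\hat{\mathbb{Z}})\to\{\pm1\}$ is defined as the composition of reduction modulo $2$, $\operatorname{GL}_2(\hat{\mathbb{Z}})\to\operatorname{GL}_2(\mathbb{F}_2)$, with the identification $\operatorname{GL}_2(\mathbb{F}_2)\simeq\mathfrak{S}_3$ (matrices acting as permutations of the three nonzero vectors of $\mathbb{F}_2^2$), followed by the sign of a permutation. $\det$ is the determinant $\operatorname{GL}_2(\hat{\mathbb{Z}})\to\hat{\mathbb{Z}}^*$. -}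

module Defs where

open import Data.Nat as ℕ using (ℕ; zero; suc; _≤_; _^_; NonZero)
import Data.Nat.Properties as ℕP
import Data.Nat.Divisibility as ℕD
open import Data.Nat.Primality using (Prime; prime⇒nonZero)
open import Data.Integer as ℤ using (ℤ; +_; _+_; _*_; _-_; -_)
open import Data.Integer.Divisibility.Signed
  using (_∣_; divides; ∣m∣n⇒∣m+n; ∣n⇒∣m*n; ∣m⇒∣m*n; ∣ᵤ⇒∣)
open import Data.Integer.DivMod using (_%ℕ_)
open import Data.Integer.Solver using (module +-*-Solver)
open import Data.Sign using (Sign)
open import Data.Bool using (Bool; true; false; if_then_else_; _xor_)
open import Data.Fin using (Fin; zero; suc; toℕ)
open import Data.Product using (Σ; _×_; _,_)
open import Relation.Binary.PropositionalEquality
  using (_≡_; refl; sym; trans; subst; cong; cong₂)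
import Data.Integer.Properties as ℤP

-- Inverse limits of rings ℤ/(mod i) over an index set I with transition
-- relation R :  an element is a family (val i ∈ ℤ, read modulo  mod i)
-- such that  val j ≡ val i  (mod  mod i)  whenever  R i j.
-- Two elements are equal when they agree modulo  mod i  for every i.

module InvLim (I : Set) (mod : I → ℕ) (R : I → I → Set) where

  record El : Set where
    field
      val    : I → ℤ
      compat : ∀ i j → R i j → (+ mod i) ∣ (val j - val i)
  open El public

  infix 4 _≈_
  _≈_ : El → El → Set
  x ≈ y = ∀ i → (+ mod i) ∣ (val x i - val y i)

  private
    open +-*-Solver
    add-lem : ∀ a b c d → (a + b) - (c + d) ≡ (a - c) + (b - d)
    add-lem = solve 4 (λ a b c d → (a :+ b) :- (c :+ d) := (a :- c) :+ (b :- d)) refl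
    mul-lem : ∀ a b c d → (a * b) - (c * d) ≡ a * (b - d) + (a - c) * d
    mul-lem = solve 4 (λ a b c d → (a :* b) :- (c :* d) := a :* (b :- d) :+ (a :- c) :* d) refl
    neg-lem : ∀ a c → (- a) - (- c) ≡ - (a - c) + (c - c) * c
    neg-lem = solve 2 (λ a c → (:- a) :- (:- c) := :- (a :- c) :+ (c :- c) :* c) refl

  const : ℤ → El
  const c = record { val = λ _ → c
                   ; compat = λ i j _ → divides (+ 0)
                       (trans (ℤP.+-inverseʳ c) (sym (ℤP.*-zeroˡ (+ mod i)))) }

  zro one : El
  zro = const (+ 0)
  one = const (+ 1)

  infixl 6 _⊕_
  infixl 7 _⊗_
  _⊕_ : El → El → El
  x ⊕ y = record
    { val    = λ i → val x i + val y i
    ; compat = λ i j r → subst (λ z → (+ mod i) ∣ z)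
                 (sym (add-lem (val x j) (val y j) (val x i) (val y i)))
                 (∣m∣n⇒∣m+n (compat x i j r) (compat y i j r)) }

  _⊗_ : El → El → El
  x ⊗ y = record
    { val    = λ i → val x i * val y i
    ; compat = λ i j r → subst (λ z → (+ mod i) ∣ z)
                 (sym (mul-lem (val x j) (val y j) (val x i) (val y i)))
                 (∣m∣n⇒∣m+n (∣n⇒∣m*n (val x j) (compat y i j r))
                            (∣m⇒∣m*n (val y i) (compat x i j r))) }

  ⊖_ : El → El
  ⊖ x = x ⊗ const (- (+ 1))

  _⊝_ : El → El → El
  x ⊝ y = x ⊕ (⊖ y)

  IsUnit : El → Set
  IsUnit x = Σ El λ y → x ⊗ y ≈ one

  record M2 : Set where
    constructor mat
    field a b c d : El
  open M2 public

  infix 4 _≈M_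
  _≈M_ : M2 → M2 → Set
  g ≈M h = (a g ≈ a h) × (b g ≈ b h) × (c g ≈ c h) × (d g ≈ d h)

  det : M2 → El
  det g = (a g ⊗ d g) ⊝ (b g ⊗ c g)

  infixl 7 _⊗M_
  _⊗M_ : M2 → M2 → M2
  g ⊗M h = mat (a g ⊗ a h ⊕ b g ⊗ c h) (a g ⊗ b h ⊕ b g ⊗ d h)
               (c g ⊗ a h ⊕ d g ⊗ c h) (c g ⊗ b h ⊕ d g ⊗ d h)

  I₂ : M2
  I₂ = mat one zro zro one

  IsGL2 : M2 → Set
  IsGL2 g = IsUnit (det g)

-- ℤ̂ = lim ℤ/mℤ  (m ≥ 1, indexed by k with m = suc k, transitions along
-- divisibility of moduli).

module Ẑ = InvLim ℕ suc (λ i j → suc i ℕD.∣ suc j)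

module Zₗ (ℓ : ℕ) = InvLim ℕ (ℓ ^_) _≤_

-- The projection π_ℓ : GL₂(ℤ̂) → GL₂(ℤ_ℓ) (component at ℓ), for ℓ prime:
-- the ℓⁿ-th level of π_ℓ(x) is the level  ℓⁿ  (index ℓⁿ - 1) of x.

module _ (ℓ : ℕ) (p : Prime ℓ) where
  private
    instance
      nz : NonZero ℓ
      nz = prime⇒nonZero p
    nzⁿ : ∀ n → NonZero (ℓ ^ n)
    nzⁿ n = ℕP.m^n≢0 ℓ n
    sp : ∀ n → suc (ℕ.pred (ℓ ^ n)) ≡ ℓ ^ n
    sp n = ℕP.suc-pred (ℓ ^ n) {{nzⁿ n}}
    pow∣ : ∀ n k → n ≤ k → (ℓ ^ n) ℕD.∣ (ℓ ^ k)
    pow∣ n k n≤k = subst (λ z → (ℓ ^ n) ℕD.∣ (ℓ ^ z)) (ℕP.m+[n∸m]≡n n≤k)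
      (subst (λ z → (ℓ ^ n) ℕD.∣ z) (sym (ℕP.^-distribˡ-+-* ℓ n (k ℕ.∸ n)))
        (ℕD.m∣m*n (ℓ ^ (k ℕ.∸ n))))

  πₗ : Ẑ.El → Zₗ.El ℓ
  πₗ x = record
    { val    = λ n → Ẑ.val x (ℕ.pred (ℓ ^ n))
    ; compat = λ n k n≤k →
        subst (λ m → (+ m) ∣ (Ẑ.val x (ℕ.pred (ℓ ^ k)) - Ẑ.val x (ℕ.pred (ℓ ^ n))))
          (sp n)
          (Ẑ.compat x (ℕ.pred (ℓ ^ n)) (ℕ.pred (ℓ ^ k))
            (subst₂∣ (sym (sp n)) (sym (sp k)) (pow∣ n k n≤k))) }
    where
    subst₂∣ : ∀ {u v u' v'} → u ≡ u' → v ≡ v' → u ℕD.∣ v → u' ℕD.∣ v'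
    subst₂∣ refl refl h = h

  πₗM : Ẑ.M2 → Zₗ.M2 ℓ
  πₗM g = Zₗ.mat (πₗ (Ẑ.a g)) (πₗ (Ẑ.b g)) (πₗ (Ẑ.c g)) (πₗ (Ẑ.d g))

-- sgn : GL₂(ℤ̂) → GL₂(𝔽₂) ≅ 𝔖₃ → {±1}.
-- Reduction mod 2 uses the level of modulus 2 (index 1).
-- The three nonzero vectors of 𝔽₂² are numbered
--   0 ↦ (1,0),  1 ↦ (0,1),  2 ↦ (1,1).

bit : Ẑ.El → Bool
bit x with Ẑ.val x 1 %ℕ 2
... | zero  = false
... | suc _ = true

vec : Fin 3 → Bool × Bool
vec zero             = true  , false
vec (suc zero)       = false , true
vec (suc (suc zero)) = true  , true

-- index of a nonzero vector of 𝔽₂² (the zero vector never occurs for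
-- invertible matrices; it is sent to 0 arbitrarily)
idx : Bool × Bool → Fin 3
idx (true  , false) = zero
idx (false , true)  = suc zero
idx (true  , true)  = suc (suc zero)
idx (false , false) = zero

_∧ᵇ_ : Bool → Bool → Bool
true ∧ᵇ y = y
false ∧ᵇ y = false

perm : Ẑ.M2 → Fin 3 → Fin 3
perm g i with vec i
... | (v₁ , v₂) =
  idx ( ((bit (Ẑ.a g) ∧ᵇ v₁) xor (bit (Ẑ.b g) ∧ᵇ v₂))
      , ((bit (Ẑ.c g) ∧ᵇ v₁) xor (bit (Ẑ.d g) ∧ᵇ v₂)) )

inv : Fin 3 → Fin 3 → Bool
inv x y = toℕ y ℕ.<ᵇ toℕ x

signPerm : (Fin 3 → Fin 3) → Sign
signPerm σ =
  if inv (σ zero) (σ (suc zero)) xor inv (σ zero) (σ (suc (suc zero)))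
       xor inv (σ (suc zero)) (σ (suc (suc zero)))
  then Sign.- else Sign.+

sgn : Ẑ.M2 → Sign
sgn g = signPerm (perm g)

-- Closed subgroups of GL₂(ℤ̂).  A subset is given as a predicate on 2×2
-- matrices over ℤ̂.  Closedness in the profinite topology: the basic open
-- neighbourhoods of g are { h : h ≡ g mod m } (m ≥ 1), so H is closed iff
-- every g which is congruent mod every m to some element of H lies in H.

_≡M_[mod-suc_] : Ẑ.M2 → Ẑ.M2 → ℕ → Set
g ≡M h [mod-suc k ] =
  ((+ suc k) ∣ (Ẑ.val (Ẑ.a g) k - Ẑ.val (Ẑ.a h) k)) ×
  ((+ suc k) ∣ (Ẑ.val (Ẑ.b g) k - Ẑ.val (Ẑ.b h) k)) ×
  ((+ suc k) ∣ (Ẑ.val (Ẑ.c g) k - Ẑ.val (Ẑ.c h) k)) ×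
  ((+ suc k) ∣ (Ẑ.val (Ẑ.d g) k - Ẑ.val (Ẑ.d h) k))

record IsClosedSubgroup (H : Ẑ.M2 → Set) : Set where
  field
    ⊆GL2   : ∀ g → H g → Ẑ.IsGL2 g
    has-I  : H Ẑ.I₂
    mul    : ∀ g h → H g → H h → H (g Ẑ.⊗M h)
    inv-∈  : ∀ g → H g → Σ Ẑ.M2 λ h → H h × (g Ẑ.⊗M h Ẑ.≈M Ẑ.I₂)
    closed : ∀ g → (∀ k → Σ Ẑ.M2 λ h → H h × (g ≡M h [mod-suc k ])) → H g

IsEverything : (Ẑ.M2 → Set) → Set
IsEverything H = ∀ g → (H g → Ẑ.IsGL2 g) × (Ẑ.IsGL2 g → H g)

-- (i) π_ℓ(H) = GL₂(ℤ_ℓ) for every prime ℓ  (π_ℓ(H) ⊆ GL₂(ℤ_ℓ) is automatic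
-- once H ⊆ GL₂(ℤ̂); we state surjectivity onto GL₂(ℤ_ℓ))
ConditionI : (Ẑ.M2 → Set) → Set
ConditionI H = ∀ ℓ → (p : Prime ℓ) → ∀ (g : Zₗ.M2 ℓ) → Zₗ.IsGL2 ℓ g →
  Σ Ẑ.M2 λ h → H h × (Zₗ._≈M_ ℓ (πₗM ℓ p h) g)

ConditionII : (Ẑ.M2 → Set) → Set
ConditionII H = ∀ (s : Sign) (u : Ẑ.El) → Ẑ.IsUnit u →
  Σ Ẑ.M2 λ h → H h × (sgn h ≡ s) × (Ẑ.det h Ẑ.≈ u)

module Submission where

-- For the converse it is enough to show that, for suitable M, every X with det X = 1 and sgn X = 1 is
-- modulo M the image of an element of H with the same two properties: by (ii) any g can be brought to
-- this form.  Take for M a power of the product of the primes ≤ L and add the primes ℓ in increasing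
-- order.  At ℓ = 2 the commutators of H suffice, since those of GL₂(ℤ₂) generate the kernel of (sgn, det).
-- At ℓ ≥ 5 a commutator of H is a transvection E₁₂(-2) at ℓ; modulo p < ℓ it permutes the p + 1 < ℓ points
-- of ℙ¹(𝔽_p), so a power with exponent prime to ℓ is trivial at all smaller primes and is still a
-- nontrivial transvection at ℓ.  Its conjugates generate SL₂(ℤ/ℓᵉ) × 1.  At ℓ = 3 the point count fails
-- for p = 2, and (ii) supplies even elements of H of determinant -1, whose commutators are trivial
-- modulo 2.  The other direction is the Chinese remainder theorem and two explicit matrices.

open import Defs
open import Data.Bool using (Bool; true; false; _xor_; _∧_) renaming (_≟_ to _≟ᵇ_)
open import Data.Fin using (Fin; toℕ; fromℕ<)
import Data.Fin.Properties as FinP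
open import Data.Integer using (ℤ; +_; _+_; _*_; _-_; -_)
open import Data.Integer.DivMod using (_%ℕ_; _/ℕ_; n%ℕd<d; a≡a%ℕn+[a/ℕn]*n)
open import Data.Integer.Divisibility.Signed using (_∣_; divides; ∣⇒∣ᵤ)
import Data.Integer.Properties as ℤP
open import Data.Integer.Tactic.RingSolver using (solve-∀)
open import Data.List using ([]; _∷_; length)
open import Data.List.Relation.Unary.All as All using (All; []; _∷_)
open import Data.Nat as ℕ using (ℕ; zero; suc; NonZero)
open import Data.Nat.Coprimality using (Coprime; prime⇒coprime; coprime-Bézout)
import Data.Nat.Divisibility as ℕD
open import Data.Nat.GCD using (module Bézout)
open import Data.Nat.Induction using (<-rec)
open import Data.Nat.ListAction using (product)
open import Data.Nat.ListAction.Properties using (∈⇒∣product)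
open import Data.Nat.Primality using (Prime; prime?; prime⇒nonZero; prime⇒nonTrivial; prime⇒irreducible; prime[2])
open import Data.Nat.Primality.Factorisation using (factorise; module PrimeFactorisation)
import Data.Nat.Properties as ℕP
open import Data.Product using (Σ; ∃₂; _×_; _,_; proj₁; proj₂)
open import Data.Sign as Sign using (Sign)
import Data.Sign.Properties as SignP
open import Data.Sum using (_⊎_; inj₁; inj₂; [_,_]′)
open import Function.Bundles using (_⇔_; mk⇔; module Equivalence)
open import Relation.Binary.PropositionalEquality using (_≡_; refl; sym; trans; cong; cong₂; subst; subst₂)
open import Relation.Nullary using (¬_; Dec; yes; no; contradiction; _→-dec_; _×-dec_)
open import Relation.Nullary.Decidable using (toWitness; from-yes; map′)

-- Congruences of integers

-- The obstacle is that (i) prescribes an element of H at one prime and says nothing about its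
-- components at the others. Commutators get around this: whatever the uncontrolled components are,
-- a commutator has determinant 1 and sign +, and its value at ℓ depends only on the prescribed
-- components. A power with exponent prime to ℓ then removes what it leaves at the smaller primes.
-- This takes the place of Goursat's lemma and a list of common simple quotients. Such an exponent
-- exists for p < ℓ as soon as ℓ does not divide p(p² - 1), the order of SL₂(𝔽_p), and the only
-- exception is p = 2, ℓ = 3. The exception is genuine: GL₂(ℤ₂) and GL₂(ℤ₃) both map onto 𝔖₃, and
-- the fibre product over 𝔖₃ (with everything at the other primes) satisfies (i). On it sgn is the
-- quadratic character modulo 3 of det, so (ii) excludes it.

pattern 0ℤ = + 0
pattern 1ℤ = + 1

infix 4 _≋_[_]
-- A record rather than an abbreviation, because unification cannot recover `x` and `y` from
-- `x - y`, which reduces.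
record _≋_[_] (x y : ℤ) (q : ℕ) : Set where
  constructor ⟨_⟩
  field by : + q ∣ x - y
open _≋_[_] public

private variable
  q n m p ℓ : ℕ
  x y z x₁ y₁ x₂ y₂ : ℤ

-- Congruences below are proved by writing the difference as an explicit combination of differences
-- already known to vanish; the ring solver checks the resulting identity.
lin0 : ∀ k → x - y ≡ k * + q → x ≋ y [ q ]
lin0 k e = ⟨ divides k e ⟩

lin1 : ∀ c → x₁ ≋ y₁ [ q ] → x - y ≡ c * (x₁ - y₁) → x ≋ y [ q ]
lin1 {q = q} c ⟨ divides k e ⟩ h = ⟨ divides (c * k) (trans h (trans (cong (c *_) e) (sym (ℤP.*-assoc c k (+ q))))) ⟩

lin2 : ∀ c c₁ → x₁ ≋ y₁ [ q ] → x₂ ≋ y₂ [ q ] →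
       x - y ≡ c * (x₁ - y₁) + c₁ * (x₂ - y₂) → x ≋ y [ q ]
lin2 {q = q} c c₁ ⟨ divides k e ⟩ ⟨ divides k₁ e₁ ⟩ h = ⟨ divides (c * k + c₁ * k₁)
  (trans h (trans (cong₂ (λ u v → c * u + c₁ * v) e e₁) (lem c k c₁ k₁ (+ q)))) ⟩
  where
  lem : ∀ c k c₁ k₁ q → c * (k * q) + c₁ * (k₁ * q) ≡ (c * k + c₁ * k₁) * q
  lem = solve-∀

≋-refl : x ≋ x [ q ]
≋-refl {x} = lin0 0ℤ (trans (ℤP.+-inverseʳ x) refl)

≋-reflexive : x ≡ y → x ≋ y [ q ]
≋-reflexive refl = ≋-refl

≋-sym : x ≋ y [ q ] → y ≋ x [ q ]
≋-sym {x} {y} h = lin1 (- 1ℤ) h (lem x y)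
  where
  lem : ∀ x y → y - x ≡ - 1ℤ * (x - y)
  lem = solve-∀

≋-trans : x ≋ y [ q ] → y ≋ z [ q ] → x ≋ z [ q ]
≋-trans {x} {y} {z = z} h k = lin2 1ℤ 1ℤ h k (lem x y z)
  where
  lem : ∀ x y z → x - z ≡ 1ℤ * (x - y) + 1ℤ * (y - z)
  lem = solve-∀

+-≋ : x ≋ y [ q ] → x₁ ≋ y₁ [ q ] → x + x₁ ≋ y + y₁ [ q ]
+-≋ {x} {y} {x₁ = x₁} {y₁} h k = lin2 1ℤ 1ℤ h k (lem x y x₁ y₁)
  where
  lem : ∀ x y x₁ y₁ → (x + x₁) - (y + y₁) ≡ 1ℤ * (x - y) + 1ℤ * (x₁ - y₁)
  lem = solve-∀

*-≋ : x ≋ y [ q ] → x₁ ≋ y₁ [ q ] → x * x₁ ≋ y * y₁ [ q ]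
*-≋ {x} {y} {x₁ = x₁} {y₁} h k = lin2 x₁ y h k (lem x y x₁ y₁)
  where
  lem : ∀ x y x₁ y₁ → (x * x₁) - (y * y₁) ≡ x₁ * (x - y) + y * (x₁ - y₁)
  lem = solve-∀

neg-≋ : x ≋ y [ q ] → - x ≋ - y [ q ]
neg-≋ {x} {y} h = lin1 (- 1ℤ) h (lem x y)
  where
  lem : ∀ x y → (- x) - (- y) ≡ - 1ℤ * (x - y)
  lem = solve-∀

-‿≋ : x ≋ y [ q ] → x₁ ≋ y₁ [ q ] → x - x₁ ≋ y - y₁ [ q ]
-‿≋ h k = +-≋ h (neg-≋ k)

≋-mono : n ℕD.∣ q → x ≋ y [ q ] → x ≋ y [ n ]
≋-mono {n} {q} (ℕD.divides t e) ⟨ divides k h ⟩ =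
  ⟨ divides (k * + t) (trans h (trans (cong (k *_) (trans (cong +_ e) (ℤP.pos-* t n))) (sym (ℤP.*-assoc k (+ t) (+ n))))) ⟩

q≋0 : ∀ {q} → + q ≋ 0ℤ [ q ]
q≋0 {q} = lin0 1ℤ (lem (+ q))
  where
  lem : ∀ q → q - 0ℤ ≡ 1ℤ * q
  lem = solve-∀

infixr 4 _,ᵤ_
record UnitMod (q : ℕ) (a : ℤ) : Set where
  constructor _,ᵤ_
  field
    inverse   : ℤ
    isInverse : a * inverse ≋ 1ℤ [ q ]
open UnitMod public

unit-≋ : x ≋ y [ q ] → UnitMod q x → UnitMod q y
unit-≋ h (x' ,ᵤ e) = x' ,ᵤ ≋-trans (*-≋ (≋-sym h) ≋-refl) e

unit-* : UnitMod q x → UnitMod q y → UnitMod q (x * y)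
unit-* {x = x} {y} (x' ,ᵤ e) (y' ,ᵤ f) = x' * y' ,ᵤ ≋-trans (≋-reflexive (lem x y x' y')) (*-≋ e f)
  where
  lem : ∀ x y x' y' → x * y * (x' * y') ≡ x * x' * (y * y')
  lem = solve-∀

-- From a·s ≡ 1 (q₁) and a·t ≡ 1 (q₂), the product (a·s - 1)(a·t - 1) vanishes modulo q₁q₂.
unit-modulus-* : ∀ {q₁ q₂} → UnitMod q₁ x → UnitMod q₂ x → UnitMod (q₁ ℕ.* q₂) x
unit-modulus-* {a} {q₁} {q₂} (s ,ᵤ ⟨ divides k e ⟩) (t ,ᵤ ⟨ divides l f ⟩) =
  s + t - a * s * t ,ᵤ
  lin0 (- (k * l)) (trans (lem₁ a s t) (trans (cong₂ (λ u v → - (u * v)) e f)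
    (trans (lem₂ k l (+ q₁) (+ q₂)) (cong (λ u → - (k * l) * u) (sym (ℤP.pos-* q₁ q₂))))))
  where
  lem₁ : ∀ a s t → a * (s + t - a * s * t) - 1ℤ ≡ - ((a * s - 1ℤ) * (a * t - 1ℤ))
  lem₁ = solve-∀
  lem₂ : ∀ k l p q → - ((k * p) * (l * q)) ≡ - (k * l) * (p * q)
  lem₂ = solve-∀

≋-mod1 : x ≋ y [ 1 ]
≋-mod1 {x} {y} = lin0 (x - y) (sym (ℤP.*-identityʳ (x - y)))

unit-modulus-^ : ∀ e → UnitMod q x → UnitMod (q ℕ.^ e) x
unit-modulus-^ zero    u = 0ℤ ,ᵤ ≋-mod1
unit-modulus-^ (suc e) u = unit-modulus-* u (unit-modulus-^ e u)

unit-pos-* : ∀ m n → UnitMod q (+ m) → UnitMod q (+ n) → UnitMod q (+ (m ℕ.* n))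
unit-pos-* m n u v = subst (UnitMod _) (sym (ℤP.pos-* m n)) (unit-* u v)

unit-pos-^ : ∀ m e → UnitMod q (+ m) → UnitMod q (+ (m ℕ.^ e))
unit-pos-^ m zero    u = 1ℤ ,ᵤ ≋-refl
unit-pos-^ m (suc e) u = unit-pos-* m (m ℕ.^ e) u (unit-pos-^ m e u)

unit-−1 : UnitMod q (- 1ℤ)
unit-−1 = - 1ℤ ,ᵤ ≋-refl

-- The relation `n * s = 1 + k * m` is read modulo `n` instead of modulo `m`, so the inverse of `m`
-- is `- k`.
unit-cop-swap : ∀ {m n} → UnitMod m (+ n) → UnitMod n (+ m)
unit-cop-swap {m} {n} (s ,ᵤ ⟨ divides k e ⟩) = - k ,ᵤ lin0 (- s)
  (trans (lem (+ m) k) (trans (cong (λ u → 1ℤ * - (u) - 1ℤ) (sym e)) (lem' (+ n) s)))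
  where
  lem : ∀ m k → m * - k - 1ℤ ≡ 1ℤ * - (k * m) - 1ℤ
  lem = solve-∀
  lem' : ∀ n s → 1ℤ * - (n * s - 1ℤ) - 1ℤ ≡ - s * n
  lem' = solve-∀

coprime⇒unit : ∀ {p n} → Coprime p n → UnitMod p (+ n)
coprime⇒unit {p} {n} c with coprime-Bézout c
... | Bézout.+- x y eq = - (+ y) ,ᵤ lin0 (- (+ x)) (trans (lem₁ (+ n) (+ y))
        (trans (cong -_ (trans (cong (λ u → 1ℤ + u) (sym (ℤP.pos-* y n))) (trans (cong +_ eq) (ℤP.pos-* x p)))) (lem₂ (+ x) (+ p))))
  where
  lem₁ : ∀ n y → n * - y - 1ℤ ≡ - (1ℤ + y * n)
  lem₁ = solve-∀
  lem₂ : ∀ x p → - (x * p) ≡ - x * p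
  lem₂ = solve-∀
... | Bézout.-+ x y eq = + y ,ᵤ lin0 (+ x) (trans (cong (_- 1ℤ)
        (trans (ℤP.*-comm (+ n) (+ y)) (trans (sym (ℤP.pos-* y n)) (trans (cong +_ (sym eq)) (cong (λ u → 1ℤ + u) (ℤP.pos-* x p))))))
        (lem (+ x * + p)))
  where
  lem : ∀ t → 1ℤ + t - 1ℤ ≡ t
  lem = solve-∀

unit-below-prime : ∀ {ℓ} → Prime ℓ → ∀ n .{{_ : NonZero n}} → n ℕ.< ℓ → UnitMod ℓ (+ n)
unit-below-prime pr n n<ℓ = coprime⇒unit (prime⇒coprime pr n<ℓ)

≋-%ℕ : ∀ z q .{{_ : NonZero q}} → z ≋ + (z %ℕ q) [ q ]
≋-%ℕ z q = lin0 (z /ℕ q) (trans (cong (_- + (z %ℕ q)) (a≡a%ℕn+[a/ℕn]*n z q)) (lem (+ (z %ℕ q)) (z /ℕ q * + q)))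
  where
  lem : ∀ r s → r + s - r ≡ s
  lem = solve-∀

zero⊎unit : ∀ {ℓ} → Prime ℓ → ∀ z → (z ≋ 0ℤ [ ℓ ]) ⊎ UnitMod ℓ z
zero⊎unit {ℓ} pr z = go (z %ℕ ℓ) (≋-%ℕ z ℓ) (n%ℕd<d z ℓ)
  where
  instance _ = prime⇒nonZero pr
  go : ∀ r → z ≋ + r [ ℓ ] → r ℕ.< ℓ → (z ≋ 0ℤ [ ℓ ]) ⊎ UnitMod ℓ z
  go zero    h _   = inj₁ h
  go (suc r) h r<ℓ = inj₂ (unit-≋ (≋-sym h) (unit-below-prime pr (suc r) r<ℓ))

-- With e = n v ≡ 1 (q) and x - y = q s = n t, write x - y = (x - y) e - (x - y)(e - 1).
≋-combine : UnitMod q (+ n) → x ≋ y [ q ] → x ≋ y [ n ] → x ≋ y [ n ℕ.* q ]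
≋-combine {q} {n} {x} {y} (v ,ᵤ ⟨ divides u h ⟩) ⟨ divides s hs ⟩ ⟨ divides t ht ⟩ =
  lin0 (s * v - t * u) (trans (lem₁ (x - y) (+ n * v)) (trans
    (cong₂ (λ α β → α * (+ n * v) - β) hs (cong₂ _*_ ht h))
    (trans (lem₂ s t u v (+ q) (+ n)) (cong ((s * v - t * u) *_) (sym (ℤP.pos-* n q))))))
  where
  lem₁ : ∀ d e → d ≡ d * e - d * (e - 1ℤ)
  lem₁ = solve-∀
  lem₂ : ∀ s t u v q n → s * q * (n * v) - t * n * (u * q) ≡ (s * v - t * u) * (n * q)
  lem₂ = solve-∀

-- Matrices modulo q

record Mat : Set where
  constructor mk
  field a b c d : ℤ

private variable
  X Y Z X' Y' W : Mat

mk-cong : ∀ {a b c d a' b' c' d'} → a ≡ a' → b ≡ b' → c ≡ c' → d ≡ d' → mk a b c d ≡ mk a' b' c' d'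
mk-cong refl refl refl refl = refl

infixl 7 _·_
𝟙 : Mat
𝟙 = mk 1ℤ 0ℤ 0ℤ 1ℤ

E₁₂ E₂₁ : ℤ → Mat
E₁₂ t = mk 1ℤ t 0ℤ 1ℤ
E₂₁ t = mk 1ℤ 0ℤ t 1ℤ

-- Opaque, so that unification compares factors instead of entries.
opaque
  _·_ : Mat → Mat → Mat
  mk a b c d · mk a' b' c' d' = mk (a * a' + b * c') (a * b' + b * d') (c * a' + d * c') (c * b' + d * d')

  detM : Mat → ℤ
  detM (mk a b c d) = a * d - b * c

opaque
  unfolding _·_ detM
  ·-mk : ∀ a b c d e f g h →
    mk a b c d · mk e f g h ≡ mk (a * e + b * g) (a * f + b * h) (c * e + d * g) (c * f + d * h)
  ·-mk a b c d e f g h = refl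

  detM-mk : ∀ a b c d → detM (mk a b c d) ≡ a * d - b * c
  detM-mk a b c d = refl

  ·-assoc : ∀ X Y Z → X · Y · Z ≡ X · (Y · Z)
  ·-assoc (mk a b c d) (mk e f g h) (mk i j k l) =
    mk-cong (lem a b e f g h i k) (lem a b e f g h j l) (lem c d e f g h i k) (lem c d e f g h j l)
    where
    lem : ∀ a b e f g h i k →
      (a * e + b * g) * i + (a * f + b * h) * k ≡ a * (e * i + f * k) + b * (g * i + h * k)
    lem = solve-∀

  ·-identityˡ : ∀ X → 𝟙 · X ≡ X
  ·-identityˡ (mk a b c d) = mk-cong (lem a c) (lem b d) (lem' a c) (lem' b d)
    where
    lem : ∀ a c → 1ℤ * a + 0ℤ * c ≡ a
    lem = solve-∀
    lem' : ∀ a c → 0ℤ * a + 1ℤ * c ≡ c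
    lem' = solve-∀

  ·-identityʳ : ∀ X → X · 𝟙 ≡ X
  ·-identityʳ (mk a b c d) = mk-cong (lem a b) (lem' a b) (lem c d) (lem' c d)
    where
    lem : ∀ a c → a * 1ℤ + c * 0ℤ ≡ a
    lem = solve-∀
    lem' : ∀ a c → a * 0ℤ + c * 1ℤ ≡ c
    lem' = solve-∀

  detM-· : ∀ X Y → detM (X · Y) ≡ detM X * detM Y
  detM-· (mk a b c d) (mk e f g h) = lem a b c d e f g h
    where
    lem : ∀ a b c d e f g h →
      (a * e + b * g) * (c * f + d * h) - (a * f + b * h) * (c * e + d * g) ≡ (a * d - b * c) * (e * h - f * g)
    lem = solve-∀

infix 4 _≈_[_]
record _≈_[_] (X Y : Mat) (q : ℕ) : Set where
  constructor entrywise
  module X = Mat X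
  module Y = Mat Y
  field
    a≋ : X.a ≋ Y.a [ q ]
    b≋ : X.b ≋ Y.b [ q ]
    c≋ : X.c ≋ Y.c [ q ]
    d≋ : X.d ≋ Y.d [ q ]
open _≈_[_] public using (a≋; b≋; c≋; d≋)

≈-refl : X ≈ X [ q ]
≈-refl = entrywise ≋-refl ≋-refl ≋-refl ≋-refl

≈-reflexive : X ≡ Y → X ≈ Y [ q ]
≈-reflexive refl = ≈-refl

≈-sym : X ≈ Y [ q ] → Y ≈ X [ q ]
≈-sym (entrywise a b c d) = entrywise (≋-sym a) (≋-sym b) (≋-sym c) (≋-sym d)

≈-trans : X ≈ Y [ q ] → Y ≈ Z [ q ] → X ≈ Z [ q ]
≈-trans (entrywise a b c d) (entrywise e f g h) = entrywise (≋-trans a e) (≋-trans b f) (≋-trans c g) (≋-trans d h)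

≈-mono : n ℕD.∣ q → X ≈ Y [ q ] → X ≈ Y [ n ]
≈-mono v (entrywise a b c d) = entrywise (≋-mono v a) (≋-mono v b) (≋-mono v c) (≋-mono v d)

≈-combine : UnitMod q (+ n) → X ≈ Y [ q ] → X ≈ Y [ n ] → X ≈ Y [ n ℕ.* q ]
≈-combine u (entrywise a b c d) (entrywise e f g h) =
  entrywise (≋-combine u a e) (≋-combine u b f) (≋-combine u c g) (≋-combine u d h)

opaque
  unfolding _·_ detM
  ·-≈ : X ≈ X' [ q ] → Y ≈ Y' [ q ] → X · Y ≈ X' · Y' [ q ]
  ·-≈ (entrywise a b c d) (entrywise e f g h) = entrywise
    (+-≋ (*-≋ a e) (*-≋ b g)) (+-≋ (*-≋ a f) (*-≋ b h)) (+-≋ (*-≋ c e) (*-≋ d g)) (+-≋ (*-≋ c f) (*-≋ d h))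

  detM-≈ : X ≈ Y [ q ] → detM X ≋ detM Y [ q ]
  detM-≈ (entrywise a b c d) = -‿≋ (*-≋ a d) (*-≋ b c)

infixr 8 _↑_
_↑_ : Mat → ℕ → Mat
X ↑ zero  = 𝟙
X ↑ suc k = X · X ↑ k

↑-≈ : ∀ k → X ≈ Y [ q ] → X ↑ k ≈ Y ↑ k [ q ]
↑-≈ zero    h = ≈-refl
↑-≈ (suc k) h = ·-≈ h (↑-≈ k h)

↑-+ : ∀ X k l → X ↑ (k ℕ.+ l) ≡ X ↑ k · X ↑ l
↑-+ X zero    l = sym (·-identityˡ (X ↑ l))
↑-+ X (suc k) l = trans (cong (X ·_) (↑-+ X k l)) (sym (·-assoc X (X ↑ k) (X ↑ l)))

↑-* : ∀ X k l → X ↑ (l ℕ.* k) ≡ (X ↑ k) ↑ l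
↑-* X k zero    = refl
↑-* X k (suc l) = trans (↑-+ X k (l ℕ.* k)) (cong (X ↑ k ·_) (↑-* X k l))

𝟙-↑ : ∀ k → 𝟙 ↑ k ≡ 𝟙
𝟙-↑ zero    = refl
𝟙-↑ (suc k) = trans (·-identityˡ (𝟙 ↑ k)) (𝟙-↑ k)

≈𝟙-↑ : ∀ k → X ≈ 𝟙 [ q ] → X ↑ k ≈ 𝟙 [ q ]
≈𝟙-↑ k h = ≈-trans (↑-≈ k h) (≈-reflexive (𝟙-↑ k))

≈𝟙-↑-multiple : ∀ X k l → X ↑ k ≈ 𝟙 [ q ] → X ↑ (l ℕ.* k) ≈ 𝟙 [ q ]
≈𝟙-↑-multiple X k l h = ≈-trans (≈-reflexive (↑-* X k l)) (≈𝟙-↑ l h)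

opaque
  unfolding _·_ detM
  E₁₂-+ : ∀ s t → E₁₂ s · E₁₂ t ≡ E₁₂ (s + t)
  E₁₂-+ s t = mk-cong (l₁ s) (l₂ s t) refl (l₃ t)
    where
    l₁ : ∀ s → 1ℤ * 1ℤ + s * 0ℤ ≡ 1ℤ
    l₁ = solve-∀
    l₂ : ∀ s t → 1ℤ * t + s * 1ℤ ≡ s + t
    l₂ = solve-∀
    l₃ : ∀ t → 0ℤ * t + 1ℤ * 1ℤ ≡ 1ℤ
    l₃ = solve-∀

  E₂₁-+ : ∀ s t → E₂₁ s · E₂₁ t ≡ E₂₁ (s + t)
  E₂₁-+ s t = mk-cong (l₃ t) refl (l₂ s t) (l₁ s)
    where
    l₁ : ∀ s → s * 0ℤ + 1ℤ * 1ℤ ≡ 1ℤ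
    l₁ = solve-∀
    l₂ : ∀ s t → s * 1ℤ + 1ℤ * t ≡ s + t
    l₂ = solve-∀
    l₃ : ∀ t → 1ℤ * 1ℤ + 0ℤ * t ≡ 1ℤ
    l₃ = solve-∀

pos-suc-* : ∀ k t → t + + k * t ≡ + suc k * t
pos-suc-* k t = sym (trans (cong (_* t) (ℤP.pos-+ 1 k)) (lem (+ k) t))
  where
  lem : ∀ k t → (1ℤ + k) * t ≡ t + k * t
  lem = solve-∀

E₁₂-↑ : ∀ k t → E₁₂ t ↑ k ≡ E₁₂ (+ k * t)
E₁₂-↑ zero    t = cong E₁₂ (sym (ℤP.*-zeroˡ t))
E₁₂-↑ (suc k) t = trans (cong (E₁₂ t ·_) (E₁₂-↑ k t)) (trans (E₁₂-+ t (+ k * t)) (cong E₁₂ (pos-suc-* k t)))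

E₂₁-↑ : ∀ k t → E₂₁ t ↑ k ≡ E₂₁ (+ k * t)
E₂₁-↑ zero    t = cong E₂₁ (sym (ℤP.*-zeroˡ t))
E₂₁-↑ (suc k) t = trans (cong (E₂₁ t ·_) (E₂₁-↑ k t)) (trans (E₂₁-+ t (+ k * t)) (cong E₂₁ (pos-suc-* k t)))

-- (𝟙 + qY)^k ≡ 𝟙 + kqY modulo q².
≈𝟙-↑-self : ∀ p → p ℕD.∣ q → X ≈ 𝟙 [ q ] → X ↑ p ≈ 𝟙 [ p ℕ.* q ]
≈𝟙-↑-self {q} {mk a b c d} p p∣q
  (entrywise ⟨ divides α ha ⟩ ⟨ divides β hb ⟩ ⟨ divides γ hc ⟩ ⟨ divides δ hd ⟩) =
  ≈-trans (≈-reflexive (cong (_↑ p) X≡)) (≈-trans (≈-mono (ℕD.*-monoˡ-∣ q p∣q) (powers p)) last)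
  where
  Q = + q
  lin : ℤ → Mat
  lin k = mk (1ℤ + k * (α * Q)) (k * (β * Q)) (k * (γ * Q)) (1ℤ + k * (δ * Q))
  X≡ : mk a b c d ≡ lin 1ℤ
  X≡ = mk-cong (trans (diag a) (cong (λ u → 1ℤ + 1ℤ * u) ha)) (trans (off b) (cong (1ℤ *_) hb))
               (trans (off c) (cong (1ℤ *_) hc)) (trans (diag d) (cong (λ u → 1ℤ + 1ℤ * u) hd))
    where
    diag : ∀ a → a ≡ 1ℤ + 1ℤ * (a - 1ℤ)
    diag = solve-∀
    off : ∀ b → b ≡ 1ℤ * (b - 0ℤ)
    off = solve-∀
  QQ : ∀ s {t} → s * (Q * Q) ≡ t → t ≡ s * + (q ℕ.* q)
  QQ s e = trans (sym e) (cong (s *_) (sym (ℤP.pos-* q q)))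
  mul : ∀ k → lin 1ℤ · lin k ≈ lin (1ℤ + k) [ q ℕ.* q ]
  mul k = ≈-trans (≈-reflexive (·-mk (1ℤ + 1ℤ * (α * Q)) (1ℤ * (β * Q)) (1ℤ * (γ * Q)) (1ℤ + 1ℤ * (δ * Q))
    (1ℤ + k * (α * Q)) (k * (β * Q)) (k * (γ * Q)) (1ℤ + k * (δ * Q)))) (entrywise
    (lin0 (k * (α * α + β * γ)) (QQ (k * (α * α + β * γ)) (e₁ α β γ k Q)))
    (lin0 (k * (α * β + β * δ)) (QQ (k * (α * β + β * δ)) (e₂ α β δ k Q)))
    (lin0 (k * (γ * α + δ * γ)) (QQ (k * (γ * α + δ * γ)) (e₃ α γ δ k Q)))
    (lin0 (k * (γ * β + δ * δ)) (QQ (k * (γ * β + δ * δ)) (e₄ γ β δ k Q))))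
    where
    e₁ : ∀ α β γ k Q → k * (α * α + β * γ) * (Q * Q) ≡
      (1ℤ + 1ℤ * (α * Q)) * (1ℤ + k * (α * Q)) + 1ℤ * (β * Q) * (k * (γ * Q)) - (1ℤ + (1ℤ + k) * (α * Q))
    e₁ = solve-∀
    e₂ : ∀ α β δ k Q → k * (α * β + β * δ) * (Q * Q) ≡
      (1ℤ + 1ℤ * (α * Q)) * (k * (β * Q)) + 1ℤ * (β * Q) * (1ℤ + k * (δ * Q)) - ((1ℤ + k) * (β * Q))
    e₂ = solve-∀
    e₃ : ∀ α γ δ k Q → k * (γ * α + δ * γ) * (Q * Q) ≡
      1ℤ * (γ * Q) * (1ℤ + k * (α * Q)) + (1ℤ + 1ℤ * (δ * Q)) * (k * (γ * Q)) - ((1ℤ + k) * (γ * Q))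
    e₃ = solve-∀
    e₄ : ∀ γ β δ k Q → k * (γ * β + δ * δ) * (Q * Q) ≡
      1ℤ * (γ * Q) * (k * (β * Q)) + (1ℤ + 1ℤ * (δ * Q)) * (1ℤ + k * (δ * Q)) - (1ℤ + (1ℤ + k) * (δ * Q))
    e₄ = solve-∀
  lin0≡ : 𝟙 ≡ lin 0ℤ
  lin0≡ = mk-cong (diag (α * Q)) (off (β * Q)) (off (γ * Q)) (diag (δ * Q))
    where
    diag : ∀ a → 1ℤ ≡ 1ℤ + 0ℤ * a
    diag = solve-∀
    off : ∀ b → 0ℤ ≡ 0ℤ * b
    off = solve-∀
  powers : ∀ k → lin 1ℤ ↑ k ≈ lin (+ k) [ q ℕ.* q ]
  powers zero    = ≈-reflexive lin0≡
  powers (suc k) = ≈-trans (·-≈ ≈-refl (powers k))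
    (subst (λ u → lin 1ℤ · lin (+ k) ≈ lin u [ q ℕ.* q ]) (sym (ℤP.pos-+ 1 k)) (mul (+ k)))
  last : lin (+ p) ≈ 𝟙 [ p ℕ.* q ]
  last = entrywise (lin0 α (diag α)) (lin0 β (off β)) (lin0 γ (off γ)) (lin0 δ (diag δ))
    where
    diag' : ∀ P α Q → 1ℤ + P * (α * Q) - 1ℤ ≡ α * (P * Q)
    diag' = solve-∀
    off' : ∀ P α Q → P * (α * Q) - 0ℤ ≡ α * (P * Q)
    off' = solve-∀
    diag : ∀ α → 1ℤ + + p * (α * Q) - 1ℤ ≡ α * + (p ℕ.* q)
    diag α = trans (diag' (+ p) α Q) (cong (α *_) (sym (ℤP.pos-* p q)))
    off : ∀ α → + p * (α * Q) - 0ℤ ≡ α * + (p ℕ.* q)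
    off α = trans (off' (+ p) α Q) (cong (α *_) (sym (ℤP.pos-* p q)))

-- Each `p`-th power gains one factor `p` in the modulus. The exponent spent, `p ^ e`, is prime to
-- every other prime ℓ.
≈𝟙-↑-^ : ∀ p e → X ≈ 𝟙 [ p ] → X ↑ (p ℕ.^ e) ≈ 𝟙 [ p ℕ.^ suc e ]
≈𝟙-↑-^ {X} p zero    h = subst (λ z → X · 𝟙 ≈ 𝟙 [ z ]) (sym (ℕP.*-identityʳ p))
  (≈-trans (≈-reflexive (·-identityʳ X)) h)
≈𝟙-↑-^ {X} p (suc e) h = ≈-trans (≈-reflexive (↑-* X (p ℕ.^ e) p))
  (≈𝟙-↑-self p (ℕD.m∣m*n (p ℕ.^ e)) (≈𝟙-↑-^ p e h))

-- Parity and sign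

isNonZero : ℕ → Bool
isNonZero zero    = false
isNonZero (suc _) = true

parity : ℤ → Bool
parity z = isNonZero (z %ℕ 2)

bit-parity : ∀ x → bit x ≡ parity (Ẑ.val x 1)
bit-parity x with Ẑ.val x 1 %ℕ 2
... | zero  = refl
... | suc _ = refl

fromBit : Bool → ℤ
fromBit false = 0ℤ
fromBit true  = 1ℤ

≋-parity : ∀ z → z ≋ fromBit (parity z) [ 2 ]
≋-parity z = go (z %ℕ 2) (≋-%ℕ z 2) (n%ℕd<d z 2)
  where
  go : ∀ r → z ≋ + r [ 2 ] → r ℕ.< 2 → z ≋ fromBit (isNonZero r) [ 2 ]
  go zero          h _ = h
  go (suc zero)    h _ = h
  go (suc (suc _)) _ (ℕ.s≤s (ℕ.s≤s ()))

1≢0mod2 : ¬ (1ℤ ≋ 0ℤ [ 2 ])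
1≢0mod2 ⟨ h ⟩ with ℕD.∣⇒≤ (∣⇒∣ᵤ h)
... | ℕ.s≤s ()

fromBit-injective : ∀ s t → fromBit s ≋ fromBit t [ 2 ] → s ≡ t
fromBit-injective false false _ = refl
fromBit-injective false true  h = contradiction (≋-sym h) 1≢0mod2
fromBit-injective true  false h = contradiction h 1≢0mod2
fromBit-injective true  true  _ = refl

parity-unique : ∀ {z} t → z ≋ fromBit t [ 2 ] → parity z ≡ t
parity-unique {z} t h = fromBit-injective (parity z) t (≋-trans (≋-sym (≋-parity z)) h)

parity-≋ : ∀ {x y} → x ≋ y [ 2 ] → parity x ≡ parity y
parity-≋ {x} {y} h = parity-unique (parity y) (≋-trans h (≋-parity y))

parity-+ : ∀ x y → parity (x + y) ≡ parity x xor parity y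
parity-+ x y = parity-unique _ (≋-trans (+-≋ (≋-parity x) (≋-parity y)) (table (parity x) (parity y)))
  where
  table : ∀ s t → fromBit s + fromBit t ≋ fromBit (s xor t) [ 2 ]
  table false false = ≋-refl
  table false true  = ≋-refl
  table true  false = ≋-refl
  table true  true  = q≋0

parity-* : ∀ x y → parity (x * y) ≡ parity x ∧ parity y
parity-* x y = parity-unique _ (≋-trans (*-≋ (≋-parity x) (≋-parity y)) (table (parity x) (parity y)))
  where
  table : ∀ s t → fromBit s * fromBit t ≋ fromBit (s ∧ t) [ 2 ]
  table false false = ≋-refl
  table false true  = ≋-refl
  table true  false = ≋-refl
  table true  true  = ≋-refl

parity-neg : ∀ x → parity (- x) ≡ parity x
parity-neg x = parity-≋ { - x} {x} (lin0 (- x) (lem x))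
  where
  lem : ∀ x → - x - x ≡ - x * + 2
  lem = solve-∀

∧-trueˡ : ∀ s t → s ∧ t ≡ true → s ≡ true
∧-trueˡ true t _ = refl

unit⇒odd : ∀ {z} → UnitMod 2 z → parity z ≡ true
unit⇒odd {z} (z' ,ᵤ e) = ∧-trueˡ (parity z) (parity z') (trans (sym (parity-* z z')) (parity-unique true e))

𝔽₂-det : Bool → Bool → Bool → Bool → Bool
𝔽₂-det a b c d = (a ∧ d) xor (b ∧ c)

-- This is `perm` with the four bits as free variables, so that facts about GL₂(𝔽₂) can be decided
-- by enumeration.
𝔽₂-perm : Bool → Bool → Bool → Bool → Fin 3 → Fin 3
𝔽₂-perm a b c d i with vec i
... | (v₁ , v₂) = idx ((a ∧ᵇ v₁) xor (b ∧ᵇ v₂) , (c ∧ᵇ v₁) xor (d ∧ᵇ v₂))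

𝔽₂-sgn : Bool → Bool → Bool → Bool → Sign
𝔽₂-sgn a b c d = signPerm (𝔽₂-perm a b c d)

∀ᵇ? : ∀ {P : Bool → Set} → (∀ b → Dec (P b)) → Dec (∀ b → P b)
∀ᵇ? {P} P? = map′ to (λ f → f true , f false) (P? true ×-dec P? false)
  where
  to : P true × P false → ∀ b → P b
  to (pt , pf) true  = pt
  to (pt , pf) false = pf

-- Decided over all 256 pairs of matrices. The determinant hypotheses confine the claim to
-- permutations: on a singular matrix `idx` meets the zero vector, and `𝔽₂-sgn` is not the sign of a
-- permutation.
𝔽₂-sgn-· : ∀ a b c d e f g h → 𝔽₂-det a b c d ≡ true → 𝔽₂-det e f g h ≡ true →
  𝔽₂-sgn ((a ∧ e) xor (b ∧ g)) ((a ∧ f) xor (b ∧ h)) ((c ∧ e) xor (d ∧ g)) ((c ∧ f) xor (d ∧ h))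
    ≡ 𝔽₂-sgn a b c d Sign.* 𝔽₂-sgn e f g h
𝔽₂-sgn-· = toWitness {a? = ∀ᵇ? λ a → ∀ᵇ? λ b → ∀ᵇ? λ c → ∀ᵇ? λ d → ∀ᵇ? λ e → ∀ᵇ? λ f → ∀ᵇ? λ g → ∀ᵇ? λ h →
  (𝔽₂-det a b c d ≟ᵇ true) →-dec ((𝔽₂-det e f g h ≟ᵇ true) →-dec (_ SignP.≟ _))} _

-- The even permutations form the cyclic group of order 3, which is commutative. This is what makes
-- commutators of even elements vanish modulo 2.
𝔽₂-even-comm : ∀ a b c d e f g h → 𝔽₂-det a b c d ≡ true → 𝔽₂-det e f g h ≡ true →
  𝔽₂-sgn a b c d ≡ Sign.+ → 𝔽₂-sgn e f g h ≡ Sign.+ →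
  (((a ∧ e) xor (b ∧ g)) ≡ ((e ∧ a) xor (f ∧ c))) × (((a ∧ f) xor (b ∧ h)) ≡ ((e ∧ b) xor (f ∧ d))) ×
  (((c ∧ e) xor (d ∧ g)) ≡ ((g ∧ a) xor (h ∧ c))) × (((c ∧ f) xor (d ∧ h)) ≡ ((g ∧ b) xor (h ∧ d)))
𝔽₂-even-comm = toWitness {a? = ∀ᵇ? λ a → ∀ᵇ? λ b → ∀ᵇ? λ c → ∀ᵇ? λ d → ∀ᵇ? λ e → ∀ᵇ? λ f → ∀ᵇ? λ g → ∀ᵇ? λ h →
  (𝔽₂-det a b c d ≟ᵇ true) →-dec ((𝔽₂-det e f g h ≟ᵇ true) →-dec
  ((𝔽₂-sgn a b c d SignP.≟ Sign.+) →-dec ((𝔽₂-sgn e f g h SignP.≟ Sign.+) →-dec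
  ((_ ≟ᵇ _) ×-dec ((_ ≟ᵇ _) ×-dec ((_ ≟ᵇ _) ×-dec (_ ≟ᵇ _)))))))} _

sgnM : Mat → Sign
sgnM (mk a b c d) = 𝔽₂-sgn (parity a) (parity b) (parity c) (parity d)

𝔽₂-sgn-cong : ∀ {a b c d a' b' c' d'} → a ≡ a' → b ≡ b' → c ≡ c' → d ≡ d' → 𝔽₂-sgn a b c d ≡ 𝔽₂-sgn a' b' c' d'
𝔽₂-sgn-cong refl refl refl refl = refl

sgnM-≈ : X ≈ Y [ 2 ] → sgnM X ≡ sgnM Y
sgnM-≈ (entrywise a b c d) = 𝔽₂-sgn-cong (parity-≋ a) (parity-≋ b) (parity-≋ c) (parity-≋ d)

parity-dot : ∀ a b c d → parity (a * b + c * d) ≡ (parity a ∧ parity b) xor (parity c ∧ parity d)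
parity-dot a b c d = trans (parity-+ (a * b) (c * d)) (cong₂ _xor_ (parity-* a b) (parity-* c d))

𝔽₂-det-odd : ∀ a b c d → UnitMod 2 (detM (mk a b c d)) →
  𝔽₂-det (parity a) (parity b) (parity c) (parity d) ≡ true
𝔽₂-det-odd a b c d u = trans (sym (trans (cong parity (detM-mk a b c d)) (trans (parity-+ (a * d) (- (b * c)))
  (cong₂ _xor_ (parity-* a d) (trans (parity-neg (b * c)) (parity-* b c)))))) (unit⇒odd u)

sgnM-· : UnitMod 2 (detM X) → UnitMod 2 (detM Y) → sgnM (X · Y) ≡ sgnM X Sign.* sgnM Y
sgnM-· {mk a b c d} {mk e f g h} u v = trans (cong sgnM (·-mk a b c d e f g h))
  (trans (𝔽₂-sgn-cong (parity-dot a e b g) (parity-dot a f b h) (parity-dot c e d g) (parity-dot c f d h))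
    (𝔽₂-sgn-· (parity a) (parity b) (parity c) (parity d) (parity e) (parity f) (parity g) (parity h)
      (𝔽₂-det-odd a b c d u) (𝔽₂-det-odd e f g h v)))

sgnM-comm : UnitMod 2 (detM X) → UnitMod 2 (detM Y) → sgnM X ≡ Sign.+ → sgnM Y ≡ Sign.+ → X · Y ≈ Y · X [ 2 ]
sgnM-comm {mk a b c d} {mk e f g h} u v s t = conclude
  (𝔽₂-even-comm (parity a) (parity b) (parity c) (parity d) (parity e) (parity f) (parity g) (parity h)
     (𝔽₂-det-odd a b c d u) (𝔽₂-det-odd e f g h v) s t)
  where
  entry : ∀ a b c d e f g h →
    (parity a ∧ parity b) xor (parity c ∧ parity d) ≡ (parity e ∧ parity f) xor (parity g ∧ parity h) →
    a * b + c * d ≋ e * f + g * h [ 2 ]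
  entry a b c d e f g h p = ≋-trans (≋-parity (a * b + c * d)) (≋-trans
    (≋-reflexive (cong fromBit (trans (parity-dot a b c d) (trans p (sym (parity-dot e f g h))))))
    (≋-sym (≋-parity (e * f + g * h))))
  conclude : _ → mk a b c d · mk e f g h ≈ mk e f g h · mk a b c d [ 2 ]
  conclude (e₁ , e₂ , e₃ , e₄) = ≈-trans (≈-reflexive (·-mk a b c d e f g h)) (≈-trans
    (entrywise (entry a e b g e a f c e₁) (entry a f b h e b f d e₂)
               (entry c e d g g a h c e₃) (entry c f d h g b h d e₄))
    (≈-reflexive (sym (·-mk e f g h a b c d))))

-- The even permutations are the powers of the 3-cycle [[0,1],[1,1]].
data Alternating (X : Mat) : Set where
  is-𝟙  : X ≈ 𝟙 [ 2 ] → Alternating X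
  is-ρ  : X ≈ mk 0ℤ 1ℤ 1ℤ 1ℤ [ 2 ] → Alternating X
  is-ρ² : X ≈ mk 1ℤ 1ℤ 1ℤ 0ℤ [ 2 ] → Alternating X

alternating : ∀ X → UnitMod 2 (detM X) → sgnM X ≡ Sign.+ → Alternating X
alternating (mk a b c d) u s = go (parity a) (parity b) (parity c) (parity d)
  (𝔽₂-det-odd a b c d u) s (≋-parity a) (≋-parity b) (≋-parity c) (≋-parity d)
  where
  go : ∀ a' b' c' d' → 𝔽₂-det a' b' c' d' ≡ true → 𝔽₂-sgn a' b' c' d' ≡ Sign.+ →
    a ≋ fromBit a' [ 2 ] → b ≋ fromBit b' [ 2 ] → c ≋ fromBit c' [ 2 ] → d ≋ fromBit d' [ 2 ] →
    Alternating (mk a b c d)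
  go true  false false true  _ _ h i j k = is-𝟙 (entrywise h i j k)
  go false true  true  true  _ _ h i j k = is-ρ (entrywise h i j k)
  go true  true  true  false _ _ h i j k = is-ρ² (entrywise h i j k)
  go true  true  false true  _ ()
  go true  false true  true  _ ()
  go false true  true  false _ ()
  go false false _     _     ()
  go true  false _     false ()
  go false true  false _     ()
  go true  true  true  true  ()
  go true  true  false false ()

-- Generators of SL₂(ℤ/ℓᵉ)

E₁₂-≈ : ∀ {s t} → s ≋ t [ q ] → E₁₂ s ≈ E₁₂ t [ q ]
E₁₂-≈ h = entrywise ≋-refl h ≋-refl ≋-refl

E₂₁-≈ : ∀ {s t} → s ≋ t [ q ] → E₂₁ s ≈ E₂₁ t [ q ]
E₂₁-≈ h = entrywise ≋-refl ≋-refl h ≋-refl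

det-E₁₂ : ∀ t → detM (E₁₂ t) ≡ 1ℤ
det-E₁₂ t = trans (detM-mk 1ℤ t 0ℤ 1ℤ) (lem t)
  where
  lem : ∀ t → 1ℤ * 1ℤ - t * 0ℤ ≡ 1ℤ
  lem = solve-∀

det-E₂₁ : ∀ t → detM (E₂₁ t) ≡ 1ℤ
det-E₂₁ t = trans (detM-mk 1ℤ 0ℤ t 1ℤ) (lem t)
  where
  lem : ∀ t → 1ℤ * 1ℤ - 0ℤ * t ≡ 1ℤ
  lem = solve-∀

det≋1-· : detM X ≋ 1ℤ [ q ] → detM Y ≋ 1ℤ [ q ] → detM (X · Y) ≋ 1ℤ [ q ]
det≋1-· {X} {_} {Y} h k = ≋-trans (≋-reflexive (detM-· X Y)) (*-≋ h k)

det≡1-· : detM X ≡ 1ℤ → detM Y ≡ 1ℤ → detM (X · Y) ≡ 1ℤ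
det≡1-· {X} {Y} h k = trans (detM-· X Y) (cong₂ _*_ h k)

det-mk≋ : ∀ {a b c d t} → detM (mk a b c d) ≋ t [ q ] → a * d - b * c ≋ t [ q ]
det-mk≋ {_} {a} {b} {c} {d} h = ≋-trans (≋-reflexive (sym (detM-mk a b c d))) h

-- The product `E₁₂ α · E₂₁ c · E₁₂ β` has diagonal `1 + α c`, `1 + c β` and lower left entry `c`.
-- Solving for `α` and `β` requires `c` to be invertible; the determinant then forces the upper
-- right entry.
SL₂-factorisation : ∀ a b c d c' → detM (mk a b c d) ≋ 1ℤ [ q ] → c * c' ≋ 1ℤ [ q ] →
  mk a b c d ≈ E₁₂ ((a - 1ℤ) * c') · E₂₁ c · E₁₂ ((d - 1ℤ) * c') [ q ]
SL₂-factorisation {q} a b c d c' δ u = ≈-sym (≈-trans (≈-reflexive expanded) (entrywise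
  (lin1 (a - 1ℤ) u (eₐ a c c')) (lin2 c' (b + (a - 1ℤ) * (d - 1ℤ) * c') (det-mk≋ δ) u (e_b a b c d c'))
  (≋-reflexive (e_c c)) (lin1 (d - 1ℤ) u (e_d c d c'))))
  where
  α = (a - 1ℤ) * c'
  β = (d - 1ℤ) * c'
  expanded : E₁₂ α · E₂₁ c · E₁₂ β ≡ mk ((1ℤ * 1ℤ + α * c) * 1ℤ + (1ℤ * 0ℤ + α * 1ℤ) * 0ℤ)
    ((1ℤ * 1ℤ + α * c) * β + (1ℤ * 0ℤ + α * 1ℤ) * 1ℤ)
    ((0ℤ * 1ℤ + 1ℤ * c) * 1ℤ + (0ℤ * 0ℤ + 1ℤ * 1ℤ) * 0ℤ)
    ((0ℤ * 1ℤ + 1ℤ * c) * β + (0ℤ * 0ℤ + 1ℤ * 1ℤ) * 1ℤ)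
  expanded = trans (cong (_· E₁₂ β) (·-mk 1ℤ α 0ℤ 1ℤ 1ℤ 0ℤ c 1ℤ))
    (·-mk (1ℤ * 1ℤ + α * c) (1ℤ * 0ℤ + α * 1ℤ) (0ℤ * 1ℤ + 1ℤ * c) (0ℤ * 0ℤ + 1ℤ * 1ℤ) 1ℤ β 0ℤ 1ℤ)
  eₐ : ∀ a c c' → (1ℤ * 1ℤ + (a - 1ℤ) * c' * c) * 1ℤ + (1ℤ * 0ℤ + (a - 1ℤ) * c' * 1ℤ) * 0ℤ - a
    ≡ (a - 1ℤ) * (c * c' - 1ℤ)
  eₐ = solve-∀
  e_b : ∀ a b c d c' → (1ℤ * 1ℤ + (a - 1ℤ) * c' * c) * ((d - 1ℤ) * c') + (1ℤ * 0ℤ + (a - 1ℤ) * c' * 1ℤ) * 1ℤ - b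
    ≡ c' * (a * d - b * c - 1ℤ) + (b + (a - 1ℤ) * (d - 1ℤ) * c') * (c * c' - 1ℤ)
  e_b = solve-∀
  e_c : ∀ c → (0ℤ * 1ℤ + 1ℤ * c) * 1ℤ + (0ℤ * 0ℤ + 1ℤ * 1ℤ) * 0ℤ ≡ c
  e_c = solve-∀
  e_d : ∀ c d c' → (0ℤ * 1ℤ + 1ℤ * c) * ((d - 1ℤ) * c') + (0ℤ * 0ℤ + 1ℤ * 1ℤ) * 1ℤ - d ≡ (d - 1ℤ) * (c * c' - 1ℤ)
  e_d = solve-∀

-- With `a` invertible, determinant 1 gives the last entry as (1 + bc)/a.
SL₂-determined : ∀ a {b c d b' c' d'} → UnitMod q a → b ≋ b' [ q ] → c ≋ c' [ q ] →
  detM (mk a b c d) ≋ 1ℤ [ q ] → detM (mk a b' c' d') ≋ 1ℤ [ q ] → mk a b c d ≈ mk a b' c' d' [ q ]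
SL₂-determined {q} a {b} {c} {d} {b'} {c'} {d'} (t ,ᵤ u) hb hc δ δ' = entrywise ≋-refl hb hc
  (lin2 1ℤ (d' - d) (*-≋ {x = t} ≋-refl ad≋ad') u (e a d d' t))
  where
  e₁ : ∀ a d b c → a * d - (1ℤ + b * c) ≡ 1ℤ * (a * d - b * c - 1ℤ)
  e₁ = solve-∀
  ad≋ad' : a * d ≋ a * d' [ q ]
  ad≋ad' = ≋-trans (lin1 1ℤ (det-mk≋ δ) (e₁ a d b c)) (≋-trans (+-≋ {x = 1ℤ} ≋-refl (*-≋ hb hc))
    (≋-sym (lin1 1ℤ (det-mk≋ δ') (e₁ a d' b' c'))))
  e : ∀ a d d' t → d - d' ≡ 1ℤ * (t * (a * d) - t * (a * d')) + (d' - d) * (a * t - 1ℤ)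
  e = solve-∀

-- `ρ` and `ρ⁻¹` are lifts of determinant 1 of the two 3-cycles of GL₂(𝔽₂). These particular lifts,
-- and `-𝟙`, are values of commutators of `E₁₂ 1ℤ`, `J` and `D`.
-𝟙 ρ ρ⁻¹ : Mat
-𝟙  = mk (- 1ℤ) 0ℤ 0ℤ (- 1ℤ)
ρ   = mk (+ 2) 1ℤ 1ℤ 1ℤ
ρ⁻¹ = mk 1ℤ (- 1ℤ) (- 1ℤ) (+ 2)

-- `T` is abstract because the argument is run on three sets: the matrices modulo `q` reached by
-- even elements of determinant 1, by those of them that are trivial modulo a coprime `n`, and by
-- even elements of arbitrary determinant.
module Generation
  (q : ℕ) {{_ : NonZero q}} (T : Mat → Set)
  (T-≈ : ∀ {X Y} → X ≈ Y [ q ] → T X → T Y)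
  (T-𝟙 : T 𝟙)
  (T-· : ∀ {X Y} → T X → T Y → T (X · Y)) where

  T-↑ : ∀ k → T X → T (X ↑ k)
  T-↑ zero    t = T-𝟙
  T-↑ (suc k) t = T-· t (T-↑ k t)

  -- Closure under inverses is not among the properties of `T`. Reducing the coefficient modulo `q`
  -- first makes a negative multiple an ordinary power.
  T-E₁₂-multiple : ∀ {α} k → T (E₁₂ α) → T (E₁₂ (k * α))
  T-E₁₂-multiple {α} k t = T-≈ (E₁₂-≈ (*-≋ (≋-sym (≋-%ℕ k q)) ≋-refl))
    (subst T (E₁₂-↑ (k %ℕ q) α) (T-↑ (k %ℕ q) t))

  T-E₂₁-multiple : ∀ {α} k → T (E₂₁ α) → T (E₂₁ (k * α))
  T-E₂₁-multiple {α} k t = T-≈ (E₂₁-≈ (*-≋ (≋-sym (≋-%ℕ k q)) ≋-refl))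
    (subst T (E₂₁-↑ (k %ℕ q) α) (T-↑ (k %ℕ q) t))

  private
    rescale : ∀ {α} (u : UnitMod q α) t → t * inverse u * α ≋ t [ q ]
    rescale {α} (α' ,ᵤ e) t = lin1 t e (lem t α α')
      where
      lem : ∀ t α α' → t * α' * α - t ≡ t * (α * α' - 1ℤ)
      lem = solve-∀

  T-E₁₂ : ∀ {α} → UnitMod q α → T (E₁₂ α) → ∀ t → T (E₁₂ t)
  T-E₁₂ u h t = T-≈ (E₁₂-≈ (rescale u t)) (T-E₁₂-multiple (t * inverse u) h)

  T-E₂₁ : ∀ {α} → UnitMod q α → T (E₂₁ α) → ∀ t → T (E₂₁ t)
  T-E₂₁ u h t = T-≈ (E₂₁-≈ (rescale u t)) (T-E₂₁-multiple (t * inverse u) h)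

  module _ {ℓ} (ℓ-prime : Prime ℓ) (e : ℕ) (q≡ : q ≡ ℓ ℕ.^ suc e)
    {α β} (uα : UnitMod ℓ α) (uβ : UnitMod ℓ β) (Tα : T (E₁₂ α)) (Tβ : T (E₂₁ β)) where

    private
      lift-unit : ∀ {z} → UnitMod ℓ z → UnitMod q z
      lift-unit u = subst (λ m → UnitMod m _) (sym q≡) (unit-modulus-^ (suc e) u)

      ℓ∣q : ℓ ℕD.∣ q
      ℓ∣q = subst (ℓ ℕD.∣_) (sym q≡) (ℕD.m∣m*n (ℓ ℕ.^ e))

      T₁₂ : ∀ t → T (E₁₂ t)
      T₁₂ = T-E₁₂ (lift-unit uα) Tα

      T₂₁ : ∀ t → T (E₂₁ t)
      T₂₁ = T-E₂₁ (lift-unit uβ) Tβ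

      c-unit : ∀ a b c d → detM (mk a b c d) ≋ 1ℤ [ q ] → UnitMod ℓ c → T (mk a b c d)
      c-unit a b c d δ u = T-≈ (≈-sym (SL₂-factorisation a b c d c' δ (isInverse (lift-unit u))))
        (T-· (T-· (T₁₂ ((a - 1ℤ) * c')) (T₂₁ c)) (T₁₂ ((d - 1ℤ) * c')))
        where c' = inverse (lift-unit u)

    SL₂-generated : ∀ Y → detM Y ≋ 1ℤ [ q ] → T Y
    SL₂-generated (mk a b c d) δ with zero⊎unit ℓ-prime c
    ... | inj₂ u = c-unit a b c d δ u
    -- Multiplying by E₂₁ 1 replaces c by a + c, a unit because a d ≡ 1 modulo ℓ.
    ... | inj₁ c≋0 = subst T Y≡ (T-· (T₂₁ (- 1ℤ)) (c-unit _ _ _ _ δ' u'))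
      where
      e₁ : ∀ a b c d → (1ℤ * a + 1ℤ * c) * d - 1ℤ ≡ 1ℤ * (a * d - b * c - 1ℤ) + (b + d) * (c - 0ℤ)
      e₁ = solve-∀
      u' : UnitMod ℓ (1ℤ * a + 1ℤ * c)
      u' = d ,ᵤ lin2 1ℤ (b + d) (≋-mono ℓ∣q (det-mk≋ δ)) c≋0 (e₁ a b c d)
      δ' : detM (mk (1ℤ * a + 0ℤ * c) (1ℤ * b + 0ℤ * d) (1ℤ * a + 1ℤ * c) (1ℤ * b + 1ℤ * d)) ≋ 1ℤ [ q ]
      δ' = subst (λ Z → detM Z ≋ 1ℤ [ q ]) (·-mk 1ℤ 0ℤ 1ℤ 1ℤ a b c d)
        (det≋1-· {E₂₁ 1ℤ} (≋-reflexive (det-E₂₁ 1ℤ)) δ)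
      Y≡ : E₂₁ (- 1ℤ) · mk (1ℤ * a + 0ℤ * c) (1ℤ * b + 0ℤ * d) (1ℤ * a + 1ℤ * c) (1ℤ * b + 1ℤ * d) ≡ mk a b c d
      Y≡ = trans (cong (E₂₁ (- 1ℤ) ·_) (sym (·-mk 1ℤ 0ℤ 1ℤ 1ℤ a b c d)))
        (trans (sym (·-assoc (E₂₁ (- 1ℤ)) (E₂₁ 1ℤ) (mk a b c d)))
        (trans (cong (_· mk a b c d) (E₂₁-+ (- 1ℤ) 1ℤ)) (·-identityˡ (mk a b c d))))

  -- Over ℤ, by Sanov's theorem, E₁₂(2) and E₂₁(2) generate the matrices of determinant 1 with even
  -- off-diagonal entries and diagonal entries 1 modulo 4; this is its analogue modulo a power of 2.
  -- `-𝟙` supplies the rest of the kernel of reduction modulo 2, and `ρ`, `ρ⁻¹` supply the two other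
  -- even cosets.
  module _ (e : ℕ) (q≡ : q ≡ 2 ℕ.^ suc e)
    (T₁₂ : T (E₁₂ (- + 2))) (T₂₁ : T (E₂₁ (+ 2))) (T-neg : T -𝟙) (Tρ : T ρ) (Tρ⁻¹ : T ρ⁻¹) where

    private
      2∣q : 2 ℕD.∣ q
      2∣q = subst (2 ℕD.∣_) (sym q≡) (ℕD.m∣m*n (2 ℕ.^ e))

      T₁₂-even : ∀ t → T (E₁₂ (+ 2 * t))
      T₁₂-even t = subst (λ z → T (E₁₂ z)) (lem t) (T-E₁₂-multiple (- t) T₁₂)
        where
        lem : ∀ t → - t * - + 2 ≡ + 2 * t
        lem = solve-∀

      T₂₁-even : ∀ t → T (E₂₁ (+ 2 * t))
      T₂₁-even t = subst (λ z → T (E₂₁ z)) (ℤP.*-comm t (+ 2)) (T-E₂₁-multiple t T₂₁)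

      -- E₁₂(2k)·E₂₁(2) has upper left entry a = 1 + 4k; s and r then correct the off-diagonal entries,
      -- and the determinant fixes the last one.
      1mod4 : ∀ k b c d → detM (mk (1ℤ + + 4 * k) (+ 2 * b) (+ 2 * c) d) ≋ 1ℤ [ q ] →
        T (mk (1ℤ + + 4 * k) (+ 2 * b) (+ 2 * c) d)
      1mod4 k b c d δ = T-≈ Y≈ (T-· (T-· (T₂₁-even s) (T-· (T₁₂-even k) (T₂₁-even 1ℤ))) (T₁₂-even r))
        where
        a = 1ℤ + + 4 * k
        lem : ∀ k → 1ℤ + + 4 * k - 1ℤ ≡ (+ 2 * k) * + 2
        lem = solve-∀
        u : UnitMod q a
        u = subst (λ m → UnitMod m a) (sym q≡) (unit-modulus-^ (suc e)
          (unit-≋ (≋-sym (lin0 (+ 2 * k) (lem k))) (1ℤ ,ᵤ ≋-refl)))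
        a' = inverse u
        s = (c - 1ℤ) * a'
        r = (b - k) * a'
        Q : Mat
        Q = mk a (a * (+ 2 * r) + + 2 * k) (a * (+ 2 * s) + + 2) ((a * (+ 2 * s) + + 2) * (+ 2 * r) + (+ 2 * s * (+ 2 * k) + 1ℤ))
        P = E₂₁ (+ 2 * s) · (E₁₂ (+ 2 * k) · E₂₁ (+ 2 * 1ℤ)) · E₁₂ (+ 2 * r)
        P≡ : P ≡ Q
        P≡ = trans (cong (λ Z → E₂₁ (+ 2 * s) · Z · E₁₂ (+ 2 * r)) (·-mk 1ℤ (+ 2 * k) 0ℤ 1ℤ 1ℤ 0ℤ (+ 2 * 1ℤ) 1ℤ))
          (trans (cong (_· E₁₂ (+ 2 * r)) (·-mk 1ℤ 0ℤ (+ 2 * s) 1ℤ _ _ _ _))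
          (trans (·-mk _ _ _ _ 1ℤ (+ 2 * r) 0ℤ 1ℤ)
          (mk-cong (e₁ k) (e₂ k r) (e₃ k s) (e₄ k s r))))
          where
          e₁ : ∀ k → (1ℤ * (1ℤ * 1ℤ + + 2 * k * (+ 2 * 1ℤ)) + 0ℤ * (0ℤ * 1ℤ + 1ℤ * (+ 2 * 1ℤ))) * 1ℤ
            + (1ℤ * (1ℤ * 0ℤ + + 2 * k * 1ℤ) + 0ℤ * (0ℤ * 0ℤ + 1ℤ * 1ℤ)) * 0ℤ ≡ 1ℤ + + 4 * k
          e₁ = solve-∀
          e₂ : ∀ k r → (1ℤ * (1ℤ * 1ℤ + + 2 * k * (+ 2 * 1ℤ)) + 0ℤ * (0ℤ * 1ℤ + 1ℤ * (+ 2 * 1ℤ))) * (+ 2 * r)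
            + (1ℤ * (1ℤ * 0ℤ + + 2 * k * 1ℤ) + 0ℤ * (0ℤ * 0ℤ + 1ℤ * 1ℤ)) * 1ℤ ≡ (1ℤ + + 4 * k) * (+ 2 * r) + + 2 * k
          e₂ = solve-∀
          e₃ : ∀ k s → (+ 2 * s * (1ℤ * 1ℤ + + 2 * k * (+ 2 * 1ℤ)) + 1ℤ * (0ℤ * 1ℤ + 1ℤ * (+ 2 * 1ℤ))) * 1ℤ
            + (+ 2 * s * (1ℤ * 0ℤ + + 2 * k * 1ℤ) + 1ℤ * (0ℤ * 0ℤ + 1ℤ * 1ℤ)) * 0ℤ ≡ (1ℤ + + 4 * k) * (+ 2 * s) + + 2
          e₃ = solve-∀
          e₄ : ∀ k s r → (+ 2 * s * (1ℤ * 1ℤ + + 2 * k * (+ 2 * 1ℤ)) + 1ℤ * (0ℤ * 1ℤ + 1ℤ * (+ 2 * 1ℤ))) * (+ 2 * r)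
            + (+ 2 * s * (1ℤ * 0ℤ + + 2 * k * 1ℤ) + 1ℤ * (0ℤ * 0ℤ + 1ℤ * 1ℤ)) * 1ℤ
            ≡ ((1ℤ + + 4 * k) * (+ 2 * s) + + 2) * (+ 2 * r) + (+ 2 * s * (+ 2 * k) + 1ℤ)
          e₄ = solve-∀
        det-P : detM P ≡ 1ℤ
        det-P = det≡1-· {E₂₁ (+ 2 * s) · (E₁₂ (+ 2 * k) · E₂₁ (+ 2 * 1ℤ))}
          (det≡1-· {E₂₁ (+ 2 * s)} (det-E₂₁ _) (det≡1-· {E₁₂ (+ 2 * k)} (det-E₁₂ _) (det-E₂₁ _))) (det-E₁₂ _)
        entry : ∀ a a' t k → a * (+ 2 * ((t - k) * a')) + + 2 * k - + 2 * t ≡ + 2 * (t - k) * (a * a' - 1ℤ)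
        entry = solve-∀
        Y≈ : P ≈ mk a (+ 2 * b) (+ 2 * c) d [ q ]
        Y≈ = ≈-trans (≈-reflexive P≡) (SL₂-determined a u
          (lin1 (+ 2 * (b - k)) (isInverse u) (entry a a' b k))
          (lin1 (+ 2 * (c - 1ℤ)) (isInverse u) (entry a a' c 1ℤ))
          (≋-reflexive (trans (cong detM (sym P≡)) det-P)) δ)

      neg-mk : ∀ a b c d → -𝟙 · mk a b c d ≡ mk (- a) (- b) (- c) (- d)
      neg-mk a b c d = trans (·-mk (- 1ℤ) 0ℤ 0ℤ (- 1ℤ) a b c d) (mk-cong (l a c) (l b d) (l' a c) (l' b d))
        where
        l : ∀ a c → - 1ℤ * a + 0ℤ * c ≡ - a
        l = solve-∀
        l' : ∀ a c → 0ℤ * a + - 1ℤ * c ≡ - c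
        l' = solve-∀

      det-neg : detM -𝟙 ≡ 1ℤ
      det-neg = detM-mk (- 1ℤ) 0ℤ 0ℤ (- 1ℤ)

      neg-neg : ∀ a b c d → -𝟙 · mk (- a) (- b) (- c) (- d) ≡ mk a b c d
      neg-neg a b c d = trans (neg-mk (- a) (- b) (- c) (- d))
        (mk-cong (ℤP.neg-involutive a) (ℤP.neg-involutive b) (ℤP.neg-involutive c) (ℤP.neg-involutive d))

      1mod2 : ∀ Y → detM Y ≋ 1ℤ [ q ] → Y ≈ 𝟙 [ 2 ] → T Y
      1mod2 (mk a b c d) δ (entrywise ⟨ divides j ha ⟩ ⟨ divides β hb ⟩ ⟨ divides γ hc ⟩ _) =
        go (parity j) (≋-parity j)
        where
        half : ∀ {b β} → b - 0ℤ ≡ β * + 2 → b ≡ + 2 * β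
        half {b} {β} h = trans (l b) (trans h (ℤP.*-comm β (+ 2)))
          where
          l : ∀ b → b ≡ b - 0ℤ
          l = solve-∀
        mod4 : ∀ a j k s → a - 1ℤ ≡ j * + 2 → j - s ≡ k * + 2 → a ≡ 1ℤ + + 2 * s + + 4 * k
        mod4 a j k s h i = trans (l₁ a j s) (trans (cong₂ (λ u v → 1ℤ + + 2 * s + (u - j * + 2) + + 2 * v) h i) (l₂ j k s))
          where
          l₁ : ∀ a j s → a ≡ 1ℤ + + 2 * s + (a - 1ℤ - j * + 2) + + 2 * (j - s)
          l₁ = solve-∀
          l₂ : ∀ j k s → 1ℤ + + 2 * s + (j * + 2 - j * + 2) + + 2 * (k * + 2) ≡ 1ℤ + + 2 * s + + 4 * k
          l₂ = solve-∀
        go : ∀ s → j ≋ fromBit s [ 2 ] → T (mk a b c d)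
        go false ⟨ divides k hj ⟩ = subst T (sym Y≡) (1mod4 k β γ d (subst (λ Z → detM Z ≋ 1ℤ [ q ]) Y≡ δ))
          where
          l : ∀ k → 1ℤ + + 2 * 0ℤ + + 4 * k ≡ 1ℤ + + 4 * k
          l = solve-∀
          Y≡ : mk a b c d ≡ mk (1ℤ + + 4 * k) (+ 2 * β) (+ 2 * γ) d
          Y≡ = mk-cong (trans (mod4 a j k 0ℤ ha hj) (l k)) (half hb) (half hc) refl
        -- Here `j` is odd, so `a` is 3 modulo 4 and `- a` is 1 modulo 4.
        go true  ⟨ divides k hj ⟩ = subst T (neg-neg a b c d)
          (T-· T-neg (subst T (sym Y≡) (1mod4 (- (1ℤ + k)) (- β) (- γ) (- d) (subst (λ Z → detM Z ≋ 1ℤ [ q ]) Y≡ δ'))))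
          where
          l : ∀ k → - (1ℤ + + 2 * 1ℤ + + 4 * k) ≡ 1ℤ + + 4 * - (1ℤ + k)
          l = solve-∀
          l' : ∀ β → - (+ 2 * β) ≡ + 2 * - β
          l' = solve-∀
          Y≡ : mk (- a) (- b) (- c) (- d) ≡ mk (1ℤ + + 4 * - (1ℤ + k)) (+ 2 * - β) (+ 2 * - γ) (- d)
          Y≡ = mk-cong (trans (cong -_ (mod4 a j k 1ℤ ha hj)) (l k)) (trans (cong -_ (half hb)) (l' β))
                 (trans (cong -_ (half hc)) (l' γ)) refl
          δ' : detM (mk (- a) (- b) (- c) (- d)) ≋ 1ℤ [ q ]
          δ' = subst (λ Z → detM Z ≋ 1ℤ [ q ]) (neg-mk a b c d) (det≋1-· { -𝟙 } (≋-reflexive det-neg) δ)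

      -- Treats a nontrivial coset of the kernel of reduction modulo 2: `V` cancels the class of
      -- `Y`, and `U`, the inverse of `V`, restores it.
      peel : ∀ {U V Y} → U · V ≡ 𝟙 → detM V ≡ 1ℤ → T U → detM Y ≋ 1ℤ [ q ] → V · Y ≈ 𝟙 [ 2 ] → T Y
      peel {U} {V} {Y} UV δV tU δ h = subst T
        (trans (sym (·-assoc U V Y)) (trans (cong (_· Y) UV) (·-identityˡ Y)))
        (T-· tU (1mod2 (V · Y) (det≋1-· {V} (≋-reflexive δV) δ) h))

    SL₂-even-generated : ∀ Y → detM Y ≋ 1ℤ [ q ] → sgnM Y ≡ Sign.+ → T Y
    SL₂-even-generated Y δ s = go (alternating Y (unit-≋ (≋-sym (≋-mono 2∣q δ)) (1ℤ ,ᵤ ≋-refl)) s)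
      where
      ρ⁻¹·ρ≈𝟙 : ρ⁻¹ · mk 0ℤ 1ℤ 1ℤ 1ℤ ≈ 𝟙 [ 2 ]
      ρ⁻¹·ρ≈𝟙 = ≈-trans (≈-reflexive (·-mk 1ℤ (- 1ℤ) (- 1ℤ) (+ 2) 0ℤ 1ℤ 1ℤ 1ℤ))
        (entrywise (lin0 (- 1ℤ) refl) (lin0 0ℤ refl) (lin0 1ℤ refl) (lin0 0ℤ refl))
      ρ·ρ²≈𝟙 : ρ · mk 1ℤ 1ℤ 1ℤ 0ℤ ≈ 𝟙 [ 2 ]
      ρ·ρ²≈𝟙 = ≈-trans (≈-reflexive (·-mk (+ 2) 1ℤ 1ℤ 1ℤ 1ℤ 1ℤ 1ℤ 0ℤ))
        (entrywise (lin0 1ℤ refl) (lin0 1ℤ refl) (lin0 1ℤ refl) (lin0 0ℤ refl))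
      go : Alternating Y → T Y
      go (is-𝟙 h)  = 1mod2 Y δ h
      go (is-ρ h)  = peel {ρ} {ρ⁻¹} {Y} (·-mk (+ 2) 1ℤ 1ℤ 1ℤ 1ℤ (- 1ℤ) (- 1ℤ) (+ 2))
        (detM-mk 1ℤ (- 1ℤ) (- 1ℤ) (+ 2)) Tρ δ (≈-trans (·-≈ {ρ⁻¹} {_} {_} {Y} ≈-refl h) ρ⁻¹·ρ≈𝟙)
      go (is-ρ² h) = peel {ρ⁻¹} {ρ} {Y} (·-mk 1ℤ (- 1ℤ) (- 1ℤ) (+ 2) (+ 2) 1ℤ 1ℤ 1ℤ)
        (detM-mk (+ 2) 1ℤ 1ℤ 1ℤ) Tρ⁻¹ δ (≈-trans (·-≈ {ρ} {_} {_} {Y} ≈-refl h) ρ·ρ²≈𝟙)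

-- Exponents prime to ℓ

act : Mat → ℤ × ℤ → ℤ × ℤ
act (mk a b c d) (s , t) = a * s + b * t , c * s + d * t

-- For two vectors that are nonzero modulo `p`, this determinant vanishes modulo `p` exactly when
-- they span the same point of ℙ¹(𝔽_p).
cross : ℤ × ℤ → ℤ × ℤ → ℤ
cross (s , t) (u , v) = s * v - t * u

opaque
  unfolding _·_ detM

  act-· : ∀ X Y v → act (X · Y) v ≡ act X (act Y v)
  act-· (mk a b c d) (mk e f g h) (s , t) = cong₂ _,_ (lem a b e f g h s t) (lem c d e f g h s t)
    where
    lem : ∀ a b e f g h s t → (a * e + b * g) * s + (a * f + b * h) * t ≡ a * (e * s + f * t) + b * (g * s + h * t)
    lem = solve-∀

  cross-act : ∀ X v w → cross (act X v) (act X w) ≡ detM X * cross v w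
  cross-act (mk a b c d) (s , t) (u , v) = lem a b c d s t u v
    where
    lem : ∀ a b c d s t u v →
      (a * s + b * t) * (c * u + d * v) - (c * s + d * t) * (a * u + b * v) ≡ (a * d - b * c) * (s * v - t * u)
    lem = solve-∀

det≋1-↑ : ∀ k → detM X ≋ 1ℤ [ q ] → detM (X ↑ k) ≋ 1ℤ [ q ]
det≋1-↑ zero    h = ≋-reflexive (det-E₁₂ 0ℤ)
det≋1-↑ {X} (suc k) h = det≋1-· {X} h (det≋1-↑ k h)

record Eigenvector (p : ℕ) (X : Mat) (v : ℤ × ℤ) : Set where
  constructor eigen
  field
    eigenvalue : ℤ
    first      : proj₁ (act X v) ≋ eigenvalue * proj₁ v [ p ]
    second     : proj₂ (act X v) ≋ eigenvalue * proj₂ v [ p ]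

eigen-· : ∀ X {Y v} → Eigenvector p X v → Eigenvector p Y v → Eigenvector p (X · Y) v
eigen-· {p} X@(mk a b c d) {Y} {v@(s , t)} (eigen κ f g) (eigen μ f' g') = eigen (μ * κ)
  (subst (λ w → proj₁ w ≋ μ * κ * s [ p ]) (sym (act-· X Y v))
    (≋-trans (+-≋ (*-≋ {x = a} ≋-refl f') (*-≋ {x = b} ≋-refl g')) (lin1 μ f (lem a b s t s κ μ))))
  (subst (λ w → proj₂ w ≋ μ * κ * t [ p ]) (sym (act-· X Y v))
    (≋-trans (+-≋ (*-≋ {x = c} ≋-refl f') (*-≋ {x = d} ≋-refl g')) (lin1 μ g (lem c d s t t κ μ))))
  where
  lem : ∀ a b s t r κ μ → a * (μ * s) + b * (μ * t) - μ * κ * r ≡ μ * (a * s + b * t - κ * r)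
  lem = solve-∀

eigen-𝟙 : ∀ v → Eigenvector p 𝟙 v
eigen-𝟙 (s , t) = eigen 1ℤ (≋-reflexive (l s t)) (≋-reflexive (l' s t))
  where
  l : ∀ s t → 1ℤ * s + 0ℤ * t ≡ 1ℤ * s
  l = solve-∀
  l' : ∀ s t → 0ℤ * s + 1ℤ * t ≡ 1ℤ * t
  l' = solve-∀

eigen-↑ : ∀ {v} k → Eigenvector p X v → Eigenvector p (X ↑ k) v
eigen-↑ {v = v} zero    h = eigen-𝟙 v
eigen-↑ {X = X} (suc k) h = eigen-· X h (eigen-↑ k h)

-- The linear form with coefficients `s` and `t` takes the value 1 at the vector, so its value at
-- the image vector is the eigenvalue.
cross≋0⇒eigen : ∀ X s t {u v} → s * u + t * v ≡ 1ℤ →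
  cross (u , v) (act X (u , v)) ≋ 0ℤ [ p ] → Eigenvector p X (u , v)
cross≋0⇒eigen {p} X s t {u} {v} h k = go (act X (u , v)) k refl
  where
  go : ∀ w → cross (u , v) w ≋ 0ℤ [ p ] → act X (u , v) ≡ w → Eigenvector p X (u , v)
  go (w₁ , w₂) k e = eigen (s * w₁ + t * w₂)
    (subst (λ w → proj₁ w ≋ (s * w₁ + t * w₂) * u [ p ]) (sym e)
      (lin1 (- t) k (trans (cong (_- (s * w₁ + t * w₂) * u) (sym (ℤP.*-identityʳ w₁)))
        (trans (cong (λ o → w₁ * o - (s * w₁ + t * w₂) * u) (sym h)) (e₁ s t u v w₁ w₂)))))
    (subst (λ w → proj₂ w ≋ (s * w₁ + t * w₂) * v [ p ]) (sym e)
      (lin1 s k (trans (cong (_- (s * w₁ + t * w₂) * v) (sym (ℤP.*-identityʳ w₂)))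
        (trans (cong (λ o → w₂ * o - (s * w₁ + t * w₂) * v) (sym h)) (e₂ s t u v w₁ w₂)))))
    where
    e₁ : ∀ s t u v w₁ w₂ → w₁ * (s * u + t * v) - (s * w₁ + t * w₂) * u ≡ - t * (u * w₂ - v * w₁ - 0ℤ)
    e₁ = solve-∀
    e₂ : ∀ s t u v w₁ w₂ → w₂ * (s * u + t * v) - (s * w₁ + t * w₂) * v ≡ s * (u * w₂ - v * w₁ - 0ℤ)
    e₂ = solve-∀

-- The point of ℙ¹(𝔽_p) spanned by (s , t): the slope s/t, or p for the point at infinity.
module _ {p} (p-prime : Prime p) where
  private instance _ = prime⇒nonZero p-prime

  slope : ∀ s t → (t ≋ 0ℤ [ p ]) ⊎ UnitMod p t → Fin (suc p)
  slope s t (inj₁ _) = fromℕ< (ℕP.n<1+n p)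
  slope s t (inj₂ (t' ,ᵤ _)) = fromℕ< (ℕP.m<n⇒m<1+n (n%ℕd<d (s * t') p))

  point : ℤ × ℤ → Fin (suc p)
  point (s , t) = slope s t (zero⊎unit p-prime t)

  slope-injective : ∀ s t u v τ υ → slope s t τ ≡ slope u v υ → cross (s , t) (u , v) ≋ 0ℤ [ p ]
  slope-injective s t u v (inj₁ h) (inj₁ k) _ = lin2 s (- u) k h (lem s t u v)
    where
    lem : ∀ s t u v → s * v - t * u - 0ℤ ≡ s * (v - 0ℤ) + - u * (t - 0ℤ)
    lem = solve-∀
  slope-injective s t u v (inj₁ h) (inj₂ (v' ,ᵤ _)) e = contradiction
    (trans (sym (FinP.toℕ-fromℕ< (ℕP.n<1+n p))) (trans (cong toℕ e)
      (FinP.toℕ-fromℕ< (ℕP.m<n⇒m<1+n (n%ℕd<d (u * v') p)))))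
    (λ eq → ℕP.<⇒≢ (n%ℕd<d (u * v') p) (sym eq))
  slope-injective s t u v (inj₂ (t' ,ᵤ _)) (inj₁ h) e = contradiction
    (trans (sym (FinP.toℕ-fromℕ< (ℕP.m<n⇒m<1+n (n%ℕd<d (s * t') p)))) (trans (cong toℕ e)
      (FinP.toℕ-fromℕ< (ℕP.n<1+n p))))
    (ℕP.<⇒≢ (n%ℕd<d (s * t') p))
  slope-injective s t u v (inj₂ (t' ,ᵤ h)) (inj₂ (v' ,ᵤ k)) e =
    ≋-trans (lin2 (- (s * v)) (u * t) h k (l₁ s t u v t' v'))
      (lin1 (t * v) (slopes≋) (l₂ s t u v t' v'))
    where
    slopes≋ : s * t' ≋ u * v' [ p ]
    slopes≋ = ≋-trans (≋-%ℕ (s * t') p) (≋-trans (≋-reflexive (cong +_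
      (trans (sym (FinP.toℕ-fromℕ< (ℕP.m<n⇒m<1+n (n%ℕd<d (s * t') p)))) (trans (cong toℕ e)
      (FinP.toℕ-fromℕ< (ℕP.m<n⇒m<1+n (n%ℕd<d (u * v') p))))))) (≋-sym (≋-%ℕ (u * v') p)))
    l₁ : ∀ s t u v t' v' → s * v - t * u - t * v * (s * t' - u * v') ≡
      - (s * v) * (t * t' - 1ℤ) + u * t * (v * v' - 1ℤ)
    l₁ = solve-∀
    l₂ : ∀ s t u v t' v' → t * v * (s * t' - u * v') - 0ℤ ≡ t * v * (s * t' - u * v')
    l₂ = solve-∀

  point-injective : ∀ v w → point v ≡ point w → cross v w ≋ 0ℤ [ p ]
  point-injective (s , t) (u , v) = slope-injective s t u v (zero⊎unit p-prime t) (zero⊎unit p-prime v)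

  -- Two of the ℓ points spanned by `X ↑ i` applied to the vector, with i < ℓ, coincide by the
  -- pigeonhole principle. The difference of the two indices is positive and below ℓ.
  eigenpower : ∀ {ℓ} → suc p ℕ.< ℓ → detM X ≋ 1ℤ [ p ] → ∀ s t u v → s * u + t * v ≡ 1ℤ →
    Σ ℕ λ k → k ℕ.< ℓ × 0 ℕ.< k × Eigenvector p (X ↑ k) (u , v)
  eigenpower {X} {ℓ} p+1<ℓ δ s t u v h = conclude (FinP.pigeonhole p+1<ℓ (λ i → orbit (toℕ i)))
    where
    orbit : ℕ → Fin (suc p)
    orbit i = point (act (X ↑ i) (u , v))
    recurrence : ∀ i k → orbit i ≡ orbit (i ℕ.+ k) → cross (u , v) (act (X ↑ k) (u , v)) ≋ 0ℤ [ p ]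
    -- Both iterates have the form `act U _`. By `cross-act` their coincidence reads
    -- `detM U * ω ≋ 0ℤ`, and `detM U ≋ 1ℤ` cancels the factor.
    recurrence i k eq = lin2 (- ω) 1ℤ (det≋1-↑ {X} i δ)
      (subst (λ z → z ≋ 0ℤ [ p ]) (cross-act U (u , v) w)
        (subst (λ z → cross (act U (u , v)) z ≋ 0ℤ [ p ]) split
          (point-injective (act U (u , v)) (act (X ↑ (i ℕ.+ k)) (u , v)) eq)))
      (lem (detM U) ω)
      where
      U = X ↑ i
      w = act (X ↑ k) (u , v)
      ω = cross (u , v) w
      split : act (X ↑ (i ℕ.+ k)) (u , v) ≡ act U w
      split = trans (cong (λ Z → act Z (u , v)) (↑-+ X i k)) (act-· U (X ↑ k) (u , v))
      lem : ∀ δ x → x - 0ℤ ≡ - x * (δ - 1ℤ) + 1ℤ * (δ * x - 0ℤ)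
      lem = solve-∀
    conclude : ∃₂ (λ (i j : Fin ℓ) → toℕ i ℕ.< toℕ j × orbit (toℕ i) ≡ orbit (toℕ j)) →
      Σ ℕ λ k → k ℕ.< ℓ × 0 ℕ.< k × Eigenvector p (X ↑ k) (u , v)
    conclude (i , j , i<j , eq) = toℕ j ℕ.∸ toℕ i ,
      ℕP.≤-<-trans (ℕP.m∸n≤m (toℕ j) (toℕ i)) (FinP.toℕ<n j) , ℕP.m<n⇒0<n∸m i<j ,
      cross≋0⇒eigen (X ↑ (toℕ j ℕ.∸ toℕ i)) s t h (recurrence (toℕ i) (toℕ j ℕ.∸ toℕ i)
        (trans eq (cong orbit (sym (ℕP.m+[n∸m]≡n (ℕP.<⇒≤ i<j))))))

-- A matrix fixing 0, ∞ and 1 on ℙ¹ is scalar; determinant 1 then says that the square of the scalar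
-- is 1.
det-1-scalar⇒involution : detM X ≋ 1ℤ [ p ] → Eigenvector p X (1ℤ , 0ℤ) → Eigenvector p X (0ℤ , 1ℤ) →
  Eigenvector p X (1ℤ , 1ℤ) → X ↑ 2 ≈ 𝟙 [ p ]
det-1-scalar⇒involution {mk a b c d} {p} δ (eigen κ _ hc) (eigen μ hb _) (eigen ν h₁ h₂) =
  ≈-trans (≈-reflexive X²) (entrywise
    (≋-trans (lin2 b (- a) c≋0 d≋a (e₁ a b c d)) ad≋1)
    (lin1 (a + d) b≋0 (e₂ a b d)) (lin1 (a + d) c≋0 (e₃ a c d))
    (≋-trans (lin2 b d c≋0 d≋a (e₄ a b c d)) ad≋1))
  where
  X² : mk a b c d ↑ 2 ≡ mk (a * a + b * c) (a * b + b * d) (c * a + d * c) (c * b + d * d)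
  X² = trans (cong (mk a b c d ·_) (·-identityʳ (mk a b c d))) (·-mk a b c d a b c d)
  c≋0 : c ≋ 0ℤ [ p ]
  c≋0 = lin1 1ℤ hc (l c d κ)
    where
    l : ∀ c d κ → c - 0ℤ ≡ 1ℤ * (c * 1ℤ + d * 0ℤ - κ * 0ℤ)
    l = solve-∀
  b≋0 : b ≋ 0ℤ [ p ]
  b≋0 = lin1 1ℤ hb (l a b μ)
    where
    l : ∀ a b μ → b - 0ℤ ≡ 1ℤ * (a * 0ℤ + b * 1ℤ - μ * 0ℤ)
    l = solve-∀
  d≋a : d ≋ a [ p ]
  d≋a = ≋-trans (lin2 1ℤ (- 1ℤ) h₂ c≋0 (l₂ c d ν)) (≋-sym (lin2 1ℤ (- 1ℤ) h₁ b≋0 (l₁ a b ν)))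
    where
    l₁ : ∀ a b ν → a - ν * 1ℤ ≡ 1ℤ * (a * 1ℤ + b * 1ℤ - ν * 1ℤ) + - 1ℤ * (b - 0ℤ)
    l₁ = solve-∀
    l₂ : ∀ c d ν → d - ν * 1ℤ ≡ 1ℤ * (c * 1ℤ + d * 1ℤ - ν * 1ℤ) + - 1ℤ * (c - 0ℤ)
    l₂ = solve-∀
  ad≋1 : a * d ≋ 1ℤ [ p ]
  ad≋1 = lin2 1ℤ b (det-mk≋ δ) c≋0 (l a b c d)
    where
    l : ∀ a b c d → a * d - 1ℤ ≡ 1ℤ * (a * d - b * c - 1ℤ) + b * (c - 0ℤ)
    l = solve-∀
  e₁ : ∀ a b c d → a * a + b * c - a * d ≡ b * (c - 0ℤ) + - a * (d - a)
  e₁ = solve-∀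
  e₂ : ∀ a b d → a * b + b * d - 0ℤ ≡ (a + d) * (b - 0ℤ)
  e₂ = solve-∀
  e₃ : ∀ a c d → c * a + d * c - 0ℤ ≡ (a + d) * (c - 0ℤ)
  e₃ = solve-∀
  e₄ : ∀ a b c d → c * b + d * d - a * d ≡ b * (c - 0ℤ) + d * (d - a)
  e₄ = solve-∀

unit-<-prime : Prime ℓ → ∀ k → k ℕ.< ℓ → 0 ℕ.< k → UnitMod ℓ (+ k)
unit-<-prime pr (suc k) k<ℓ _ = unit-below-prime pr (suc k) k<ℓ

-- Three powers fix the points 0, ∞, 1 of ℙ¹(𝔽_p); orbits have fewer than ℓ elements, so the exponents are prime to ℓ.
prime-power-exponent : Prime ℓ → Prime p → suc p ℕ.< ℓ → ∀ e → detM X ≋ 1ℤ [ p ] →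
  Σ ℕ λ k → UnitMod ℓ (+ k) × X ↑ k ≈ 𝟙 [ p ℕ.^ suc e ]
prime-power-exponent {ℓ} {p} {X} ℓ-prime p-prime p+1<ℓ e δ =
  conclude (eigenpower p-prime {X = X} p+1<ℓ δ 1ℤ 0ℤ 1ℤ 0ℤ refl)
  where
  1<p : 1 ℕ.< p
  1<p = ℕ.nonTrivial⇒n>1 p {{prime⇒nonTrivial p-prime}}
  p<ℓ : p ℕ.< ℓ
  p<ℓ = ℕP.<-trans (ℕP.n<1+n p) p+1<ℓ
  power-unit : UnitMod ℓ (+ (p ℕ.^ e))
  power-unit = unit-pos-^ p e (unit-<-prime ℓ-prime p p<ℓ (ℕP.<-trans (ℕ.s≤s ℕ.z≤n) 1<p))
  two-unit : UnitMod ℓ (+ 2)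
  two-unit = unit-<-prime ℓ-prime 2 (ℕP.≤-<-trans 1<p p<ℓ) (ℕ.s≤s ℕ.z≤n)
  HasEigenpower : Mat → ℤ × ℤ → Set
  HasEigenpower Y v = Σ ℕ λ k → k ℕ.< ℓ × 0 ℕ.< k × Eigenvector p (Y ↑ k) v
  conclude : HasEigenpower X (1ℤ , 0ℤ) → Σ ℕ λ k → UnitMod ℓ (+ k) × X ↑ k ≈ 𝟙 [ p ℕ.^ suc e ]
  conclude (k₁ , k₁<ℓ , 0<k₁ , h₁) = conclude₂ (eigenpower p-prime {X = X₁} p+1<ℓ δ₁ 0ℤ 1ℤ 0ℤ 1ℤ refl)
    where
    X₁ = X ↑ k₁
    δ₁ : detM X₁ ≋ 1ℤ [ p ]
    δ₁ = det≋1-↑ {X} k₁ δ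
    conclude₂ : HasEigenpower X₁ (0ℤ , 1ℤ) → Σ ℕ λ k → UnitMod ℓ (+ k) × X ↑ k ≈ 𝟙 [ p ℕ.^ suc e ]
    conclude₂ (k₂ , k₂<ℓ , 0<k₂ , h₂) = conclude₃ (eigenpower p-prime {X = X₂} p+1<ℓ δ₂ 1ℤ 0ℤ 1ℤ 1ℤ refl)
      where
      X₂ = X₁ ↑ k₂
      δ₂ : detM X₂ ≋ 1ℤ [ p ]
      δ₂ = det≋1-↑ {X₁} k₂ δ₁
      conclude₃ : HasEigenpower X₂ (1ℤ , 1ℤ) → Σ ℕ λ k → UnitMod ℓ (+ k) × X ↑ k ≈ 𝟙 [ p ℕ.^ suc e ]
      -- The factor 2 removes the scalar, whose square is 1, and the factor `p ^ e` raises the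
      -- modulus from `p` to `p ^ suc e`. Both are prime to ℓ since 2 ≤ p < ℓ.
      conclude₃ (k₃ , k₃<ℓ , 0<k₃ , h₃) = p ℕ.^ e ℕ.* (2 ℕ.* (k₃ ℕ.* (k₂ ℕ.* k₁))) ,
        unit-pos-* (p ℕ.^ e) (2 ℕ.* (k₃ ℕ.* (k₂ ℕ.* k₁))) power-unit (unit-pos-* 2 (k₃ ℕ.* (k₂ ℕ.* k₁)) two-unit
          (unit-pos-* k₃ (k₂ ℕ.* k₁) (unit-<-prime ℓ-prime k₃ k₃<ℓ 0<k₃)
          (unit-pos-* k₂ k₁ (unit-<-prime ℓ-prime k₂ k₂<ℓ 0<k₂) (unit-<-prime ℓ-prime k₁ k₁<ℓ 0<k₁)))) ,
        subst (λ Z → Z ≈ 𝟙 [ p ℕ.^ suc e ]) (sym tower) (≈𝟙-↑-^ {X₃ ↑ 2} p e (det-1-scalar⇒involution {X₃}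
          (det≋1-↑ {X₂} k₃ δ₂) (eigen-↑ {X = X₂} k₃ (eigen-↑ {X = X₁} k₂ h₁)) (eigen-↑ {X = X₂} k₃ h₂) h₃))
        where
        X₃ = X₂ ↑ k₃
        tower : X ↑ (p ℕ.^ e ℕ.* (2 ℕ.* (k₃ ℕ.* (k₂ ℕ.* k₁)))) ≡ (X₃ ↑ 2) ↑ (p ℕ.^ e)
        tower = trans (↑-* X (2 ℕ.* (k₃ ℕ.* (k₂ ℕ.* k₁))) (p ℕ.^ e)) (cong (_↑ (p ℕ.^ e))
          (trans (↑-* X (k₃ ℕ.* (k₂ ℕ.* k₁)) 2) (cong (_↑ 2)
          (trans (↑-* X (k₂ ℕ.* k₁) k₃) (cong (_↑ k₃) (↑-* X k₁ k₂))))))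

-- Primorials and exponents for several primes

primorial : ℕ → ℕ
-- The decision is an argument so that proofs about `primorial (suc n)` can split on
-- `prime? (suc n)` in a local function.
primorial-step : ∀ n → Dec (Prime n) → ℕ → ℕ

primorial zero    = 1
primorial (suc n) = primorial-step (suc n) (prime? (suc n)) (primorial n)

primorial-step n (yes _) k = k ℕ.* n
primorial-step n (no _)  k = k

primorial-nonZero : ∀ n → NonZero (primorial n)
primorial-nonZero zero    = _
primorial-nonZero (suc n) = go (prime? (suc n))
  where
  go : ∀ t → NonZero (primorial-step (suc n) t (primorial n))
  go (yes _) = ℕP.m*n≢0 (primorial n) (suc n) {{primorial-nonZero n}}
  go (no _)  = primorial-nonZero n

unit-primorial : Prime ℓ → ∀ n → n ℕ.< ℓ → UnitMod ℓ (+ primorial n)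
unit-primorial ℓ-prime zero    _   = 1ℤ ,ᵤ ≋-refl
unit-primorial {ℓ} ℓ-prime (suc n) n<ℓ = go (prime? (suc n))
  where
  u = unit-primorial ℓ-prime n (ℕP.<-trans (ℕP.n<1+n n) n<ℓ)
  go : ∀ t → UnitMod ℓ (+ primorial-step (suc n) t (primorial n))
  go (yes _) = unit-pos-* (primorial n) (suc n) u (unit-below-prime ℓ-prime (suc n) n<ℓ)
  go (no _)  = u

^-distribʳ-* : ∀ m n e → (m ℕ.* n) ℕ.^ e ≡ m ℕ.^ e ℕ.* n ℕ.^ e
^-distribʳ-* m n zero    = refl
^-distribʳ-* m n (suc e) = trans (cong (m ℕ.* n ℕ.*_) (^-distribʳ-* m n e)) (ℕP.[m*n]*[o*p]≡[m*o]*[n*p] m n (m ℕ.^ e) (n ℕ.^ e))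

even⊎even-suc : ∀ n → 2 ℕD.∣ n ⊎ 2 ℕD.∣ suc n
even⊎even-suc zero    = inj₁ (ℕD.divides 0 refl)
even⊎even-suc (suc n) with even⊎even-suc n
... | inj₁ h = inj₂ (ℕD.∣m∣n⇒∣m+n {n = n} (ℕD.divides 1 refl) h)
... | inj₂ h = inj₁ h

even-prime : Prime p → 2 ℕD.∣ p → p ≡ 2
even-prime p-prime 2∣p with prime⇒irreducible p-prime 2∣p
... | inj₂ 2≡p = sym 2≡p

-- Of two consecutive numbers one is even, and an even prime is 2. Hence `suc p ≡ ℓ` would make ℓ
-- equal to 2 or 3.
prime-gap : Prime ℓ → 3 ℕ.< ℓ → Prime p → p ℕ.< ℓ → suc p ℕ.< ℓ
prime-gap {ℓ} {p} ℓ-prime 3<ℓ p-prime p<ℓ = ℕP.≤∧≢⇒< p<ℓ (λ e → absurd e (even⊎even-suc p))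
  where
  absurd : suc p ≡ ℓ → ¬ (2 ℕD.∣ p ⊎ 2 ℕD.∣ suc p)
  absurd e (inj₁ h) = ℕP.<-irrefl (trans (cong suc (sym (even-prime p-prime h))) e) 3<ℓ
  absurd e (inj₂ h) = ℕP.<⇒≢ (ℕP.<-trans (ℕP.n<1+n 2) 3<ℓ)
    (sym (even-prime ℓ-prime (subst (2 ℕD.∣_) e h)))

-- The exponents found for the individual primes are multiplied, which keeps the result prime to ℓ,
-- and the congruences are joined by the Chinese remainder theorem.
primorial-exponent : Prime ℓ → 3 ℕ.< ℓ → ∀ e n → n ℕ.< ℓ → detM X ≋ 1ℤ [ primorial n ℕ.^ suc e ] →
  Σ ℕ λ k → UnitMod ℓ (+ k) × X ↑ k ≈ 𝟙 [ primorial n ℕ.^ suc e ]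
primorial-exponent {ℓ} {X} ℓ-prime 3<ℓ e zero n<ℓ δ =
  1 , (1ℤ ,ᵤ ≋-refl) , subst (λ m → X ↑ 1 ≈ 𝟙 [ m ]) (sym (ℕP.^-zeroˡ (suc e))) (entrywise ≋-mod1 ≋-mod1 ≋-mod1 ≋-mod1)
primorial-exponent {ℓ} {X} ℓ-prime 3<ℓ e (suc n) n<ℓ = go (prime? (suc n))
  where
  n<ℓ' = ℕP.<-trans (ℕP.n<1+n n) n<ℓ
  N = primorial n
  go : ∀ t → let P = primorial-step (suc n) t N in detM X ≋ 1ℤ [ P ℕ.^ suc e ] →
    Σ ℕ λ k → UnitMod ℓ (+ k) × X ↑ k ≈ 𝟙 [ P ℕ.^ suc e ]
  go (no _)  δ = primorial-exponent ℓ-prime 3<ℓ e n n<ℓ' δ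
  go (yes p-prime) δ = combine (primorial-exponent ℓ-prime 3<ℓ e n n<ℓ' (≋-mono (ℕD.m∣m*n (suc n ℕ.^ suc e)) δ'))
    (prime-power-exponent {X = X} ℓ-prime p-prime (prime-gap ℓ-prime 3<ℓ p-prime n<ℓ) e
      (≋-mono (ℕD.∣-trans (ℕD.m∣m*n (suc n ℕ.^ e)) (ℕD.n∣m*n (N ℕ.^ suc e))) δ'))
    where
    split = ^-distribʳ-* N (suc n) (suc e)
    δ' : detM X ≋ 1ℤ [ N ℕ.^ suc e ℕ.* suc n ℕ.^ suc e ]
    δ' = subst (λ m → detM X ≋ 1ℤ [ m ]) split δ
    coprime : UnitMod (suc n ℕ.^ suc e) (+ (N ℕ.^ suc e))
    coprime = unit-modulus-^ (suc e) (unit-pos-^ N (suc e) (unit-primorial p-prime n (ℕP.n<1+n n)))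
    combine : (Σ ℕ λ k → UnitMod ℓ (+ k) × X ↑ k ≈ 𝟙 [ N ℕ.^ suc e ]) →
      (Σ ℕ λ k → UnitMod ℓ (+ k) × X ↑ k ≈ 𝟙 [ suc n ℕ.^ suc e ]) →
      Σ ℕ λ k → UnitMod ℓ (+ k) × X ↑ k ≈ 𝟙 [ (N ℕ.* suc n) ℕ.^ suc e ]
    combine (k , u , h) (l , v , i) = l ℕ.* k , unit-pos-* l k v u ,
      subst (λ m → X ↑ (l ℕ.* k) ≈ 𝟙 [ m ]) (sym split)
        (≈-combine coprime (subst (λ m → X ↑ m ≈ 𝟙 [ suc n ℕ.^ suc e ]) (ℕP.*-comm k l) (≈𝟙-↑-multiple X l k i))
          (≈𝟙-↑-multiple X k l h))

-- The image of H in GL₂(ℤ/M)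

-- `J` is the Weyl element, whose conjugation carries `E₁₂` to `E₂₁`. Conjugation by `D` inverts
-- `E₁₂ t`, so that the commutator of the two is `E₁₂ (-2t)`. The coefficient -2 is a unit at odd
-- primes, and at 2 it generates the even coefficients.
J J⁻¹ D : Mat
J   = mk 0ℤ 1ℤ (- 1ℤ) 0ℤ
J⁻¹ = mk 0ℤ (- 1ℤ) 1ℤ 0ℤ
D   = mk (- 1ℤ) 0ℤ 0ℤ 1ℤ

opaque
  unfolding _·_ detM

  J·J⁻¹ : J · J⁻¹ ≡ 𝟙
  J·J⁻¹ = refl

  D·D : D · D ≡ 𝟙
  D·D = refl

  det-J : detM J ≡ 1ℤ
  det-J = refl

  det-D : detM D ≡ - 1ℤ
  det-D = refl

  [D,E₁₂] : D · E₁₂ 1ℤ · (D · E₁₂ (- 1ℤ)) ≡ E₁₂ (- + 2)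
  [D,E₁₂] = refl

  [D,E₁₂²] : D · E₁₂ (+ 2) · (D · E₁₂ (- + 2)) ≡ E₁₂ (- + 4)
  [D,E₁₂²] = refl

  [D,J] : D · J · (D · J⁻¹) ≡ -𝟙
  [D,J] = refl

  [E₁₂,J] : E₁₂ 1ℤ · J · (E₁₂ (- 1ℤ) · J⁻¹) ≡ ρ
  [E₁₂,J] = refl

  [J,E₁₂] : J · E₁₂ 1ℤ · (J⁻¹ · E₁₂ (- 1ℤ)) ≡ ρ⁻¹
  [J,E₁₂] = refl

  J-conj-E₁₂ : ∀ t → J · E₁₂ t · J⁻¹ ≡ E₂₁ (- t)
  J-conj-E₁₂ t = mk-cong (l₁ t) (l₃ t) (l₂ t) (l₄ t)
    where
    l₁ : ∀ t → (0ℤ * 1ℤ + 1ℤ * 0ℤ) * 0ℤ + (0ℤ * t + 1ℤ * 1ℤ) * 1ℤ ≡ 1ℤ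
    l₁ = solve-∀
    l₂ : ∀ t → (- 1ℤ * 1ℤ + 0ℤ * 0ℤ) * 0ℤ + (- 1ℤ * t + 0ℤ * 1ℤ) * 1ℤ ≡ - t
    l₂ = solve-∀
    l₃ : ∀ t → (0ℤ * 1ℤ + 1ℤ * 0ℤ) * - 1ℤ + (0ℤ * t + 1ℤ * 1ℤ) * 0ℤ ≡ 0ℤ
    l₃ = solve-∀
    l₄ : ∀ t → (- 1ℤ * 1ℤ + 0ℤ * 0ℤ) * - 1ℤ + (- 1ℤ * t + 0ℤ * 1ℤ) * 0ℤ ≡ 1ℤ
    l₄ = solve-∀

-- Only the class modulo `q` is prescribed; membership in `S` carries what must be known of the
-- witness at the other primes.
Near : (Mat → Set) → ℕ → Mat → Set
Near S q Y = Σ Mat λ Z → S Z × Z ≈ Y [ q ]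

square-sign : ∀ s t → s Sign.* t ≡ Sign.+ → s ≡ t
square-sign Sign.- Sign.- _ = refl
square-sign Sign.+ Sign.+ _ = refl

record IsSubgroupMod (M : ℕ) (R : Mat → Set) : Set where
  field
    resp : X ≈ Y [ M ] → R X → R Y
    one  : R 𝟙
    mul  : R X → R Y → R (X · Y)
    rinv : R X → Σ Mat λ X' → R X' × X · X' ≈ 𝟙 [ M ]

-- R stands for the image of H in GL₂(ℤ/M), as a set of integer matrices closed under congruence modulo M.
module Finite
  {M : ℕ} (2∣M : 2 ℕD.∣ M) {R : Mat → Set} (R-subgroup : IsSubgroupMod M R)
  (R-lift : ∀ {ℓ} → Prime ℓ → ∀ e → ℓ ℕ.^ e ℕD.∣ M → ∀ Y → detM Y ≡ 1ℤ ⊎ detM Y ≡ - 1ℤ → Near R (ℓ ℕ.^ e) Y)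
  (R-flip : Σ Mat λ X → R X × detM X ≋ - 1ℤ [ M ] × sgnM X ≡ Sign.+) where

  open IsSubgroupMod R-subgroup renaming (resp to R-≈; one to R-𝟙; mul to R-·)

  record Inverse (X : Mat) : Set where
    constructor is-inverse
    field
      X⁻¹      : Mat
      member   : R X⁻¹
      inverseʳ : X · X⁻¹ ≈ 𝟙 [ M ]
      inverseˡ : X⁻¹ · X ≈ 𝟙 [ M ]

  -- `rinv` gives right inverses. The right inverse of `X'` agrees with `X` modulo `M`, so `X'` is
  -- also a left inverse.
  R-inverse : R X → Inverse X
  R-inverse {X} h = go (rinv h)
    where
    go : (Σ Mat λ X' → R X' × X · X' ≈ 𝟙 [ M ]) → Inverse X
    go (X' , h' , e) = go' (rinv h')
      where
      go' : (Σ Mat λ X'' → R X'' × X' · X'' ≈ 𝟙 [ M ]) → Inverse X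
      go' (X'' , _ , e') = is-inverse X' h' e (≈-trans (·-≈ {X'} ≈-refl X≈X'') e')
        where
        X≈X'' : X ≈ X'' [ M ]
        X≈X'' = ≈-trans (≈-reflexive (sym (·-identityʳ X))) (≈-trans (·-≈ {X} ≈-refl (≈-sym e'))
          (≈-trans (≈-reflexive (sym (·-assoc X X' X''))) (≈-trans (·-≈ e ≈-refl) (≈-reflexive (·-identityˡ X'')))))

  det-inverse : (i : Inverse X) → detM X * detM (Inverse.X⁻¹ i) ≋ 1ℤ [ M ]
  det-inverse {X} (is-inverse X' _ e _) = ≋-trans (≋-reflexive (sym (detM-· X X')))
    (≋-trans (detM-≈ e) (≋-reflexive (det-E₁₂ 0ℤ)))

  R-odd : R X → UnitMod 2 (detM X)
  R-odd h = detM (Inverse.X⁻¹ (R-inverse h)) ,ᵤ ≋-mono 2∣M (det-inverse (R-inverse h))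

  sgn-· : R X → R Y → sgnM (X · Y) ≡ sgnM X Sign.* sgnM Y
  sgn-· h k = sgnM-· (R-odd h) (R-odd k)

  sgn-inverse : R X → (i : Inverse X) → sgnM X ≡ sgnM (Inverse.X⁻¹ i)
  sgn-inverse {X} h (is-inverse X' h' e _) =
    square-sign (sgnM X) (sgnM X') (trans (sym (sgn-· h h')) (sgnM-≈ (≈-mono 2∣M e)))

  record R₁ (X : Mat) : Set where
    constructor _,₁_,₁_
    field
      member : R X
      det≋1  : detM X ≋ 1ℤ [ M ]
      even   : sgnM X ≡ Sign.+

  R₁-𝟙 : R₁ 𝟙
  R₁-𝟙 = R-𝟙 ,₁ ≋-reflexive (det-E₁₂ 0ℤ) ,₁ refl

  even-· : R X → R Y → sgnM X ≡ Sign.+ → sgnM Y ≡ Sign.+ → sgnM (X · Y) ≡ Sign.+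
  even-· h k s t = trans (sgn-· h k) (cong₂ Sign._*_ s t)

  R₁-· : R₁ X → R₁ Y → R₁ (X · Y)
  R₁-· {X} (h ,₁ δ ,₁ s) (k ,₁ ε ,₁ t) = R-· h k ,₁ det≋1-· {X} δ ε ,₁ even-· h k s t

  R₁-↑ : ∀ k → R₁ X → R₁ (X ↑ k)
  R₁-↑ zero    h = R₁-𝟙
  R₁-↑ (suc k) h = R₁-· h (R₁-↑ k h)

  sgn-conj : R W → (i : Inverse W) → R X → sgnM X ≡ Sign.+ → sgnM (W · X · Inverse.X⁻¹ i) ≡ Sign.+
  sgn-conj {W} {X} w i@(is-inverse W' w' _ _) h s = trans (sgn-· (R-· w h) w')
    (trans (cong₂ Sign._*_ (trans (sgn-· w h) (cong₂ Sign._*_ (sgn-inverse w i) s)) refl)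
    (trans (cong (Sign._* sgnM W') (SignP.*-identityʳ (sgnM W'))) (SignP.s*s≡+ (sgnM W'))))

  R₁-conj : R W → (i : Inverse W) → R₁ X → R₁ (W · X · Inverse.X⁻¹ i)
  R₁-conj {W} {X} w i@(is-inverse W' w' e _) (h ,₁ δ ,₁ s) = R-· (R-· w h) w' ,₁
    ≋-trans (≋-reflexive (trans (detM-· (W · X) W') (cong (_* detM W') (detM-· W X))))
      (lin2 (detM W * detM W') 1ℤ δ (det-inverse i) (lem (detM W) (detM X) (detM W'))) ,₁
    sgn-conj w i h s
    where
    lem : ∀ w x w' → w * x * w' - 1ℤ ≡ w * w' * (x - 1ℤ) + 1ℤ * (w * w' - 1ℤ)
    lem = solve-∀

  conj-𝟙 : n ℕD.∣ M → (i : Inverse W) → X ≈ 𝟙 [ n ] → W · X · Inverse.X⁻¹ i ≈ 𝟙 [ n ]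
  conj-𝟙 {W = W} n∣M (is-inverse W' _ e _) h = ≈-trans (·-≈ (·-≈ {W} ≈-refl h) (≈-refl {W'}))
    (≈-trans (≈-reflexive (cong (_· W') (·-identityʳ W))) (≈-mono n∣M e))

  inverse-≈ : q ℕD.∣ M → (i : Inverse X) → ∀ {A A'} → X ≈ A [ q ] → A · A' ≡ 𝟙 → Inverse.X⁻¹ i ≈ A' [ q ]
  inverse-≈ {X = X} q∣M (is-inverse X' _ _ e) {A} {A'} h k = ≈-trans (≈-reflexive (sym (·-identityʳ X')))
    (≈-trans (≈-reflexive (cong (X' ·_) (sym k))) (≈-trans (·-≈ {X'} ≈-refl (·-≈ (≈-sym h) (≈-refl {A'})))
    (≈-trans (≈-reflexive (sym (·-assoc X' X A'))) (≈-trans (·-≈ (≈-mono q∣M e) (≈-refl {A'}))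
    (≈-reflexive (·-identityˡ A'))))))

  -- `member` holds whatever `X` and `Y` are. `value` computes the commutator modulo any `q` where
  -- both are known, and `trivial-2` controls it modulo 2 where only their signs are known.
  record Commutator (X Y : Mat) : Set where
    field
      C         : Mat
      member    : R₁ C
      value     : ∀ {q A A' B B'} → q ℕD.∣ M → X ≈ A [ q ] → A · A' ≡ 𝟙 → Y ≈ B [ q ] → B · B' ≡ 𝟙 →
                  C ≈ A · B · (A' · B') [ q ]
      trivial-2 : sgnM X ≡ Sign.+ → sgnM Y ≡ Sign.+ → C ≈ 𝟙 [ 2 ]

  commutator : R X → R Y → Commutator X Y
  commutator {X} {Y} h k = go (R-inverse h) (R-inverse k)
    where
    go : Inverse X → Inverse Y → Commutator X Y
    go i@(is-inverse X' h' ex _) j@(is-inverse Y' k' ey _) = record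
      { C         = X · Y · (X' · Y')
      ; member    = R-· (R-· h k) (R-· h' k') ,₁
          ≋-trans (≋-reflexive (trans (detM-· (X · Y) (X' · Y')) (cong₂ _*_ (detM-· X Y) (detM-· X' Y'))))
            (lin2 (detM Y * detM Y') 1ℤ (det-inverse i) (det-inverse j) (lem (detM X) (detM Y) (detM X') (detM Y'))) ,₁
          trans (sgn-· (R-· h k) (R-· h' k')) (trans (cong₂ Sign._*_ (trans (sgn-· h k)
            (cong₂ Sign._*_ (sgn-inverse h i) (sgn-inverse k j))) (sgn-· h' k')) (SignP.s*s≡+ (sgnM X' Sign.* sgnM Y')))
      ; value     = λ q∣M hx a hy b → ·-≈ (·-≈ hx hy) (·-≈ (inverse-≈ q∣M i hx a) (inverse-≈ q∣M j hy b))
      ; trivial-2 = λ s t → ≈-trans (·-≈ (sgnM-comm (R-odd h) (R-odd k) s t) (≈-refl {X' · Y'}))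
          (≈-trans (≈-reflexive (trans (·-assoc Y X (X' · Y')) (cong (Y ·_) (sym (·-assoc X X' Y')))))
          (≈-trans (·-≈ {Y} ≈-refl (·-≈ (≈-mono 2∣M ex) (≈-refl {Y'})))
          (≈-trans (≈-reflexive (cong (Y ·_) (·-identityˡ Y'))) (≈-mono 2∣M ey))))
      }
      where
      lem : ∀ x y x' y' → x * y * (x' * y') - 1ℤ ≡ y * y' * (x * x' - 1ℤ) + 1ℤ * (y * y' - 1ℤ)
      lem = solve-∀

  near-≈ : ∀ {S} → X ≈ Y [ q ] → Near S q X → Near S q Y
  near-≈ h (Z , s , e) = Z , s , ≈-trans e h

  near-· : ∀ {S : Mat → Set} → (∀ {X Y} → S X → S Y → S (X · Y)) → Near S q X → Near S q Y → Near S q (X · Y)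
  near-· mul (Z , s , e) (Z' , s' , e') = Z · Z' , mul s s' , ·-≈ e e'

  near-commutator : ∀ {A A' B B'} → q ℕD.∣ M → A · A' ≡ 𝟙 → B · B' ≡ 𝟙 →
    Near R q A → Near R q B → Near R₁ q (A · B · (A' · B'))
  near-commutator q∣M a b (X , h , e) (Y , k , f) = C , member , value q∣M e a f b
    where open Commutator (commutator h k)

  module AtPrime {ℓ} (ℓ-prime : Prime ℓ) (e : ℕ) (q∣M : ℓ ℕ.^ suc e ℕD.∣ M) where
    Q : ℕ
    Q = ℓ ℕ.^ suc e

    instance
      Q-nonZero : NonZero Q
      Q-nonZero = ℕP.m^n≢0 ℓ (suc e) {{prime⇒nonZero ℓ-prime}}

    lift-E₁₂ : Near R Q (E₁₂ 1ℤ)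
    lift-E₁₂ = R-lift ℓ-prime (suc e) q∣M (E₁₂ 1ℤ) (inj₁ (det-E₁₂ 1ℤ))

    lift-J : Near R Q J
    lift-J = R-lift ℓ-prime (suc e) q∣M J (inj₁ det-J)

    lift-D : Near R Q D
    lift-D = R-lift ℓ-prime (suc e) q∣M D (inj₂ det-D)

    near-[D,E₁₂] : Near R₁ Q (E₁₂ (- + 2))
    near-[D,E₁₂] = subst (Near R₁ Q) [D,E₁₂] (near-commutator q∣M D·D (E₁₂-+ 1ℤ (- 1ℤ)) lift-D lift-E₁₂)

    -- The conjugating element is a lift of `J` with unknown components at the other primes, hence
    -- the demand that `S` be stable under conjugation by all of `R`.
    near-E₂₁ : ∀ {S : Mat → Set} → (∀ {W X} → R W → (i : Inverse W) → S X → S (W · X · Inverse.X⁻¹ i)) →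
      ∀ t → Near S Q (E₁₂ t) → Near S Q (E₂₁ (- t))
    near-E₂₁ {S} conj t (X , s , f) = go lift-J
      where
      go : Near R Q J → Near S Q (E₂₁ (- t))
      go (W , w , g) = W · X · Inverse.X⁻¹ i , conj w i s ,
        subst (λ Z → W · X · Inverse.X⁻¹ i ≈ Z [ Q ]) (J-conj-E₁₂ t) (·-≈ (·-≈ g f) (inverse-≈ q∣M i g J·J⁻¹))
        where i = R-inverse w

  Full : ℕ → Set
  Full n = ∀ Y → detM Y ≋ 1ℤ [ n ] → sgnM Y ≡ Sign.+ → Near R₁ n Y

  full-2 : ∀ e → 2 ℕ.^ suc e ℕD.∣ M → Full (2 ℕ.^ suc e)
  full-2 e q∣M = SL₂-even-generated e refl near-[D,E₁₂]
    (near-E₂₁ R₁-conj (- + 2) near-[D,E₁₂])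
    (subst (Near R₁ Q) [D,J] (near-commutator q∣M D·D J·J⁻¹ lift-D lift-J))
    (subst (Near R₁ Q) [E₁₂,J] (near-commutator q∣M (E₁₂-+ 1ℤ (- 1ℤ)) J·J⁻¹ lift-E₁₂ lift-J))
    (subst (Near R₁ Q) [J,E₁₂] (near-commutator q∣M J·J⁻¹ (E₁₂-+ 1ℤ (- 1ℤ)) lift-J lift-E₁₂))
    where
    open AtPrime prime[2] e q∣M
    open Generation Q (Near R₁ Q) near-≈ (𝟙 , R₁-𝟙 , ≈-refl) (near-· R₁-·)

  R₁[_] : ℕ → Mat → Set
  R₁[ n ] Z = R₁ Z × Z ≈ 𝟙 [ n ]

  R₁[]-· : R₁[ n ] X → R₁[ n ] Y → R₁[ n ] (X · Y)
  R₁[]-· (h , e) (k , f) = R₁-· h k , ≈-trans (·-≈ e f) (≈-reflexive (·-identityˡ 𝟙))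

  -- An approximation `X` of `Y` modulo `n` is corrected by some `Z` in the kernel modulo `n` that
  -- is `Y · X⁻¹` modulo `q`; then `Z · X` is right modulo both.
  full-* : n ℕ.* q ℕD.∣ M → UnitMod q (+ n) → Full n →
    (∀ Y → detM Y ≋ 1ℤ [ q ] → Near R₁[ n ] q Y) → Full (n ℕ.* q)
  full-* {n} {q} nq∣M u full kernel Y δ s = go (full Y (≋-mono (ℕD.m∣m*n q) δ) s)
    where
    q∣M : q ℕD.∣ M
    q∣M = ℕD.∣-trans (ℕD.n∣m*n n) nq∣M
    go : Near R₁ n Y → Near R₁ (n ℕ.* q) Y
    go (X , h@(hR ,₁ δX ,₁ _) , e) = go' (R-inverse hR)
      where
      go' : Inverse X → Near R₁ (n ℕ.* q) Y
      go' i@(is-inverse X' _ _ eˡ) = go'' (kernel (Y · X')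
          (≋-trans (≋-reflexive (detM-· Y X')) (*-≋ (≋-mono (ℕD.n∣m*n n) δ) (≋-mono q∣M δX'))))
        where
        lem : ∀ x x' → x' - 1ℤ ≡ 1ℤ * (x * x' - 1ℤ) + - x' * (x - 1ℤ)
        lem = solve-∀
        δX' : detM X' ≋ 1ℤ [ M ]
        δX' = lin2 1ℤ (- detM X') (det-inverse i) δX (lem (detM X) (detM X'))
        go'' : Near R₁[ n ] q (Y · X') → Near R₁ (n ℕ.* q) Y
        go'' (Z , (z , ez) , f) = Z · X , R₁-· z h , ≈-combine u
          (≈-trans (·-≈ f (≈-refl {X})) (≈-trans (≈-reflexive (·-assoc Y X' X))
            (≈-trans (·-≈ {Y} ≈-refl (≈-mono q∣M eˡ)) (≈-reflexive (·-identityʳ Y)))))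
          (≈-trans (·-≈ ez e) (≈-reflexive (·-identityˡ Y)))

  module _ {ℓ} (ℓ-prime : Prime ℓ) (e : ℕ) (q∣M : ℓ ℕ.^ suc e ℕD.∣ M) where
    open AtPrime ℓ-prime e q∣M

    -- The elements trivial modulo `n` are stable under conjugation, so a transvection among them
    -- brings along its conjugate by a lift of `J`, and the two generate.
    kernel : n ℕD.∣ M → ∀ c → UnitMod ℓ c → Near R₁[ n ] Q (E₁₂ c) →
      ∀ Y → detM Y ≋ 1ℤ [ Q ] → Near R₁[ n ] Q Y
    kernel {n} n∣M c u h = SL₂-generated ℓ-prime e refl u (unit-≋ (≋-reflexive (ℤP.-1*i≡-i c)) (unit-* unit-−1 u)) h
      (near-E₂₁ (λ w i (t , f) → R₁-conj w i t , conj-𝟙 n∣M i f) c h)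
      where open Generation Q (Near R₁[ n ] Q) near-≈ (𝟙 , (R₁-𝟙 , ≈-refl) , ≈-refl) (near-· R₁[]-·)

    kernel-power : n ℕD.∣ M → ∀ k c → UnitMod ℓ (+ k) → UnitMod ℓ c → (h : Near R₁ Q (E₁₂ c)) →
      proj₁ h ↑ k ≈ 𝟙 [ n ] → ∀ Y → detM Y ≋ 1ℤ [ Q ] → Near R₁[ n ] Q Y
    kernel-power n∣M k c u v (C , h , f) g = kernel n∣M (+ k * c) (unit-* u v)
      (C ↑ k , (R₁-↑ k h , g) , ≈-trans (↑-≈ k f) (≈-reflexive (E₁₂-↑ k c)))

    kernel-large : 3 ℕ.< ℓ → ∀ {m} → m ℕ.< ℓ → primorial m ℕ.^ suc e ℕD.∣ M →
      ∀ Y → detM Y ≋ 1ℤ [ Q ] → Near R₁[ primorial m ℕ.^ suc e ] Q Y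
    kernel-large 3<ℓ {m} m<ℓ n∣M = go near-[D,E₁₂]
      where
      2-unit : UnitMod ℓ (- + 2)
      2-unit = unit-* unit-−1 (unit-<-prime ℓ-prime 2 (ℕP.<-trans (ℕP.n<1+n 2) 3<ℓ) (ℕ.s≤s ℕ.z≤n))
      go : Near R₁ Q (E₁₂ (- + 2)) → ∀ Y → detM Y ≋ 1ℤ [ Q ] → Near R₁[ primorial m ℕ.^ suc e ] Q Y
      go h@(C , c , _) = go' (primorial-exponent {X = C} ℓ-prime 3<ℓ e m m<ℓ (≋-mono n∣M (R₁.det≋1 c)))
        where
        go' : (Σ ℕ λ k → UnitMod ℓ (+ k) × C ↑ k ≈ 𝟙 [ primorial m ℕ.^ suc e ]) →
          ∀ Y → detM Y ≋ 1ℤ [ Q ] → Near R₁[ primorial m ℕ.^ suc e ] Q Y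
        go' (k , u , g) = kernel-power n∣M k (- + 2) u 2-unit h g

  -- GL₂(ℤ₂) and GL₂(ℤ₃) share the quotient 𝔖₃.  Even elements commute modulo 2, and by R-flip even
  -- elements of R still reach D modulo powers of 3, so a commutator of even elements serves as E₁₂.
  kernel-3 : ∀ e → 3 ℕ.^ suc e ℕD.∣ M → 2 ℕ.^ suc e ℕD.∣ M →
    ∀ Y → detM Y ≋ 1ℤ [ 3 ℕ.^ suc e ] → Near R₁[ 2 ℕ.^ suc e ] (3 ℕ.^ suc e) Y
  kernel-3 e q∣M n∣M = go R-flip
    where
    prime[3] : Prime 3
    prime[3] = from-yes (prime? 3)
    open AtPrime prime[3] e q∣M
    Even : Mat → Set
    Even X = R X × sgnM X ≡ Sign.+
    even·even : ∀ {X Y} → Even X → Even Y → Even (X · Y)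
    even·even (h , s) (k , t) = R-· h k , even-· h k s t
    -- A square has sign +, and the resulting coefficient 2 is still a unit modulo 3.
    square : Near R Q (E₁₂ 1ℤ) → Near Even Q (E₁₂ (+ 2))
    square (U , h , f) = U · U , (R-· h h , trans (sgn-· h h) (SignP.s*s≡+ (sgnM U))) ,
      ≈-trans (·-≈ f f) (≈-reflexive (E₁₂-+ 1ℤ 1ℤ))
    even-E₁₂ : Near Even Q (E₁₂ (+ 2))
    even-E₁₂ = square lift-E₁₂
    open Generation Q (Near Even Q) near-≈ (𝟙 , (R-𝟙 , refl) , ≈-refl) (near-· even·even)
    even-SL₂ : ∀ Y → detM Y ≋ 1ℤ [ Q ] → Near Even Q Y
    even-SL₂ = SL₂-generated prime[3] e refl (+ 2 ,ᵤ lin0 1ℤ refl) (1ℤ ,ᵤ lin0 (- 1ℤ) refl) even-E₁₂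
      (near-E₂₁ (λ w i (h , s) → R-· (R-· w h) (Inverse.member i) , sgn-conj w i h s) (+ 2) even-E₁₂)
    go : (Σ Mat λ X → R X × detM X ≋ - 1ℤ [ M ] × sgnM X ≡ Sign.+) →
      ∀ Y → detM Y ≋ 1ℤ [ Q ] → Near R₁[ 2 ℕ.^ suc e ] Q Y
    go (X , h , δ , s) = go' (R-inverse h)
      where
      go' : Inverse X → ∀ Y → detM Y ≋ 1ℤ [ Q ] → Near R₁[ 2 ℕ.^ suc e ] Q Y
      -- `X` is even of determinant -1 but unknown at 3. The discrepancy `D · X'` has determinant 1,
      -- hence is reached by an even `Z`, and `Z · X` is even and equal to `D` at 3.
      go' i@(is-inverse X' _ _ eˡ) = go'' (even-SL₂ (D · X') δ') even-E₁₂
        where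
        lem : ∀ x x' → - 1ℤ * x' - 1ℤ ≡ 1ℤ * (x * x' - 1ℤ) + - x' * (x - - 1ℤ)
        lem = solve-∀
        δ' : detM (D · X') ≋ 1ℤ [ Q ]
        δ' = ≋-trans (≋-reflexive (trans (detM-· D X') (cong (_* detM X') det-D)))
          (≋-mono q∣M (lin2 1ℤ (- detM X') (det-inverse i) δ (lem (detM X) (detM X'))))
        go'' : Near Even Q (D · X') → Near Even Q (E₁₂ (+ 2)) → ∀ Y → detM Y ≋ 1ℤ [ Q ] → Near R₁[ 2 ℕ.^ suc e ] Q Y
        -- The commutator of `D` with `E₁₂ 2` is `E₁₂ (-4)`. It is trivial modulo 2, and its power
        -- `2 ^ e`, an exponent prime to 3, is trivial modulo `2 ^ suc e`.
        go'' (Z , (z , t) , f) (U , (u , r) , g) = kernel-power prime[3] e q∣M n∣M (2 ℕ.^ e) (- + 4)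
            (unit-pos-^ 2 e (+ 2 ,ᵤ lin0 1ℤ refl)) (- 1ℤ ,ᵤ lin0 1ℤ refl)
            (C , member , subst (λ V → C ≈ V [ Q ]) [D,E₁₂²] (value q∣M ZX≈D D·D g (E₁₂-+ (+ 2) (- + 2))))
            (≈𝟙-↑-^ 2 e (trivial-2 (even-· z h t s) r))
          where
          open Commutator (commutator (R-· z h) u)
          ZX≈D : Z · X ≈ D [ Q ]
          ZX≈D = ≈-trans (·-≈ f (≈-refl {X})) (≈-trans (≈-reflexive (·-assoc D X' X))
            (≈-trans (·-≈ {D} ≈-refl (≈-mono q∣M eˡ)) (≈-reflexive (·-identityʳ D))))

  -- The index is shifted by 2 because the induction starts from the prime 2: `primorial 2` computes
  -- to 2.
  full-primorial : ∀ e k → primorial (2 ℕ.+ k) ℕ.^ suc e ℕD.∣ M → Full (primorial (2 ℕ.+ k) ℕ.^ suc e)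
  full-primorial e zero    n∣M = full-2 e n∣M
  full-primorial e (suc k) = go (prime? (3 ℕ.+ k))
    where
    N = primorial (2 ℕ.+ k)
    E = suc e
    kernel-at : ∀ k → Prime (3 ℕ.+ k) → (3 ℕ.+ k) ℕ.^ E ℕD.∣ M → primorial (2 ℕ.+ k) ℕ.^ E ℕD.∣ M →
      ∀ Y → detM Y ≋ 1ℤ [ (3 ℕ.+ k) ℕ.^ E ] → Near R₁[ primorial (2 ℕ.+ k) ℕ.^ E ] ((3 ℕ.+ k) ℕ.^ E) Y
    -- `zero` is the prime 3. From `suc k` on ℓ is at least 4, which is the bound that
    -- `kernel-large` asks for.
    kernel-at zero    _       = kernel-3 e
    kernel-at (suc k) ℓ-prime q∣M n∣M = kernel-large ℓ-prime e q∣M (ℕ.s≤s (ℕ.s≤s (ℕ.s≤s (ℕ.s≤s ℕ.z≤n)))) (ℕP.n<1+n _) n∣M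
    go : ∀ t → let P = primorial-step (3 ℕ.+ k) t N in P ℕ.^ E ℕD.∣ M → Full (P ℕ.^ E)
    go (no _)        n∣M = full-primorial e k n∣M
    go (yes ℓ-prime) n∣M = subst Full (sym split) (full-* nq∣M
        (unit-modulus-^ E (unit-pos-^ N E (unit-primorial ℓ-prime (2 ℕ.+ k) (ℕP.n<1+n _))))
        (full-primorial e k left) (kernel-at k ℓ-prime (ℕD.∣-trans (ℕD.n∣m*n (N ℕ.^ E)) nq∣M) left))
      where
      split = ^-distribʳ-* N (3 ℕ.+ k) E
      nq∣M : N ℕ.^ E ℕ.* (3 ℕ.+ k) ℕ.^ E ℕD.∣ M
      nq∣M = subst (ℕD._∣ M) split n∣M
      left = ℕD.∣-trans (ℕD.m∣m*n ((3 ℕ.+ k) ℕ.^ E)) nq∣M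

-- From finite levels to ℤ̂

prime-∣-primorial : ∀ n → Prime p → p ℕ.≤ n → p ℕD.∣ primorial n
prime-∣-primorial zero    p-prime p≤0 = contradiction p≤0
  (ℕP.<⇒≱ (ℕ.>-nonZero⁻¹ _ {{prime⇒nonZero p-prime}}))
prime-∣-primorial {p} (suc n) p-prime p≤n = go (prime? (suc n)) (ℕP.m≤n⇒m<n∨m≡n p≤n)
  where
  go : ∀ t → p ℕ.< suc n ⊎ p ≡ suc n → p ℕD.∣ primorial-step (suc n) t (primorial n)
  go (yes _) (inj₁ h)    = ℕD.∣-trans (prime-∣-primorial n p-prime (ℕP.≤-pred h)) (ℕD.m∣m*n (suc n))
  go (no _)  (inj₁ h)    = prime-∣-primorial n p-prime (ℕP.≤-pred h)
  go (yes _) (inj₂ refl) = ℕD.n∣m*n (primorial n)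
  go (no ¬p) (inj₂ refl) = contradiction p-prime ¬p

-- The number of prime factors, counted with multiplicity, bounds every multiplicity. The extra
-- factor from `suc e` makes each prime up to `n`, in particular 2, divide the modulus even when `m`
-- is 1.
∣-primorial-power : ∀ n m .{{_ : NonZero m}} → m ℕ.≤ n → Σ ℕ λ e → m ℕD.∣ primorial n ℕ.^ suc e
∣-primorial-power n m m≤n = length factors ,
  ℕD.∣-trans (subst (ℕD._∣ primorial n ℕ.^ length factors) (sym isFactorisation) (product-∣ factors divides-primorial)) (ℕD.n∣m*n (primorial n))
  where
  open PrimeFactorisation (factorise m)
  divides-primorial : All (ℕD._∣ primorial n) factors
  divides-primorial = All.tabulate (λ i → prime-∣-primorial n (All.lookup factorsPrime i)
    (ℕP.≤-trans (ℕD.∣⇒≤ (subst (_ ℕD.∣_) (sym isFactorisation) (∈⇒∣product i))) m≤n))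
  product-∣ : ∀ ps → All (ℕD._∣ primorial n) ps → product ps ℕD.∣ primorial n ℕ.^ length ps
  product-∣ []       []       = ℕD.∣-refl
  product-∣ (p ∷ ps) (h ∷ hs) = ℕD.*-pres-∣ h (product-∣ ps hs)

level : Ẑ.M2 → ℕ → Mat
level g k = mk (Ẑ.val (Ẑ.a g) k) (Ẑ.val (Ẑ.b g) k) (Ẑ.val (Ẑ.c g) k) (Ẑ.val (Ẑ.d g) k)

level-⊗M : ∀ g h k → level (g Ẑ.⊗M h) k ≡ level g k · level h k
level-⊗M g h k = sym (·-mk _ _ _ _ _ _ _ _)

val-det : ∀ g k → Ẑ.val (Ẑ.det g) k ≡ detM (level g k)
val-det g k = trans (lem (Ẑ.val (Ẑ.a g) k) (Ẑ.val (Ẑ.b g) k) (Ẑ.val (Ẑ.c g) k) (Ẑ.val (Ẑ.d g) k))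
  (sym (detM-mk _ _ _ _))
  where
  lem : ∀ a b c d → a * d + b * c * - 1ℤ ≡ a * d - b * c
  lem = solve-∀

level-compat : ∀ g i j → suc i ℕD.∣ suc j → level g j ≈ level g i [ suc i ]
level-compat g i j h = entrywise ⟨ Ẑ.compat (Ẑ.a g) i j h ⟩ ⟨ Ẑ.compat (Ẑ.b g) i j h ⟩
  ⟨ Ẑ.compat (Ẑ.c g) i j h ⟩ ⟨ Ẑ.compat (Ẑ.d g) i j h ⟩

≈⇒≡M : ∀ g h k → level g k ≈ level h k [ suc k ] → g ≡M h [mod-suc k ]
≈⇒≡M g h k (entrywise ⟨ a ⟩ ⟨ b ⟩ ⟨ c ⟩ ⟨ d ⟩) = a , b , c , d

≈M⇒≈ : ∀ g h k → g Ẑ.≈M h → level g k ≈ level h k [ suc k ]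
≈M⇒≈ g h k (a , b , c , d) = entrywise ⟨ a k ⟩ ⟨ b k ⟩ ⟨ c k ⟩ ⟨ d k ⟩

sgn-level-1 : ∀ g → sgn g ≡ sgnM (level g 1)
sgn-level-1 g = 𝔽₂-sgn-cong (bit-parity (Ẑ.a g)) (bit-parity (Ẑ.b g)) (bit-parity (Ẑ.c g)) (bit-parity (Ẑ.d g))

module _ {H : Ẑ.M2 → Set} (closed-subgroup : IsClosedSubgroup H)
  (i : ConditionI H) (ii : ConditionII H) where

  open IsClosedSubgroup closed-subgroup

  module AtLevel (κ : ℕ) (2∣M : 2 ℕD.∣ suc κ) where
    M : ℕ
    M = suc κ

    R : Mat → Set
    R X = Σ Ẑ.M2 λ h → H h × level h κ ≈ X [ M ]

    sgn-level : ∀ g → sgnM (level g κ) ≡ sgn g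
    sgn-level g = trans (sgnM-≈ (level-compat g 1 κ 2∣M)) (sym (sgn-level-1 g))

    R-subgroup : IsSubgroupMod M R
    R-subgroup = record
      { resp = λ e (h , x , f) → h , x , ≈-trans f e
      ; one  = Ẑ.I₂ , has-I , ≈-refl
      ; mul  = λ (g , x , e) (h , y , f) → g Ẑ.⊗M h , mul g h x y , ≈-trans (≈-reflexive (level-⊗M g h κ)) (·-≈ e f)
      ; rinv = λ (g , x , e) → inverse-level g e (inv-∈ g x)
      }
      where
      inverse-level : ∀ g {X} → level g κ ≈ X [ M ] → (Σ Ẑ.M2 λ h → H h × (g Ẑ.⊗M h Ẑ.≈M Ẑ.I₂)) →
        Σ Mat λ X' → R X' × X · X' ≈ 𝟙 [ M ]
      inverse-level g e (h , y , f) = level h κ , (h , y , ≈-refl) ,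
        ≈-trans (·-≈ (≈-sym e) (≈-refl {level h κ}))
          (≈-trans (≈-reflexive (sym (level-⊗M g h κ))) (≈M⇒≈ (g Ẑ.⊗M h) Ẑ.I₂ κ f))

    R-lift : ∀ {ℓ} → Prime ℓ → ∀ e → ℓ ℕ.^ e ℕD.∣ M → ∀ Y → detM Y ≡ 1ℤ ⊎ detM Y ≡ - 1ℤ → Near R (ℓ ℕ.^ e) Y
    R-lift {ℓ} ℓ-prime e q∣M Y@(mk y₁ y₂ y₃ y₄) δ = go (i ℓ ℓ-prime g unit)
      where
      open Zₗ ℓ using (const)
      g : Zₗ.M2 ℓ
      g = Zₗ.mat (const y₁) (const y₂) (const y₃) (const y₄)
      detM≡ : ∀ a b c d → a * d + b * c * - 1ℤ ≡ a * d - b * c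
      detM≡ = solve-∀
      det-unit : ∀ ε → detM Y * ε ≡ 1ℤ → Zₗ.IsGL2 ℓ g
      det-unit ε h = const ε , λ n → by (≋-reflexive (trans (cong (_* ε)
        (trans (detM≡ y₁ y₂ y₃ y₄) (sym (detM-mk y₁ y₂ y₃ y₄)))) h))
      unit : Zₗ.IsGL2 ℓ g
      -- A determinant equal to 1 or -1 is its own inverse.
      unit = [ (λ h → det-unit 1ℤ (cong (_* 1ℤ) h)) , (λ h → det-unit (- 1ℤ) (cong (_* - 1ℤ) h)) ]′ δ
      ℓᵉ : ℕ
      ℓᵉ = ℓ ℕ.^ e
      suc-pred : suc (ℕ.pred ℓᵉ) ≡ ℓᵉ
      suc-pred = ℕP.suc-pred ℓᵉ {{ℕP.m^n≢0 ℓ e {{prime⇒nonZero ℓ-prime}}}}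
      go : (Σ Ẑ.M2 λ h → H h × (Zₗ._≈M_ ℓ (πₗM ℓ ℓ-prime h) g)) → Near R (ℓ ℕ.^ e) Y
      go (h , x , (a , b , c , d)) = level h κ , (h , x , ≈-refl) , ≈-trans
        (subst (λ m → level h κ ≈ level h (ℕ.pred ℓᵉ) [ m ]) suc-pred
          (level-compat h (ℕ.pred ℓᵉ) κ (subst (ℕD._∣ M) (sym suc-pred) q∣M)))
        (entrywise ⟨ a e ⟩ ⟨ b e ⟩ ⟨ c e ⟩ ⟨ d e ⟩)

    R-flip : Σ Mat λ X → R X × detM X ≋ - 1ℤ [ M ] × sgnM X ≡ Sign.+
    R-flip = go (ii Sign.+ (Ẑ.const (- 1ℤ)) (Ẑ.const (- 1ℤ) , λ k → by (≋-refl {1ℤ})))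
      where
      go : (Σ Ẑ.M2 λ h → H h × (sgn h ≡ Sign.+) × (Ẑ.det h Ẑ.≈ Ẑ.const (- 1ℤ))) →
        Σ Mat λ X → R X × detM X ≋ - 1ℤ [ M ] × sgnM X ≡ Sign.+
      go (h , x , s , δ) = level h κ , (h , x , ≈-refl) ,
        ≋-trans (≋-reflexive (sym (val-det h κ))) ⟨ δ κ ⟩ , trans (sgn-level h) s

    open Finite 2∣M R-subgroup R-lift R-flip public

    R-level : Full M → ∀ g → Ẑ.IsGL2 g → R (level g κ)
    R-level full g unit = go (ii (sgn g) (Ẑ.det g) unit)
      where
      G = level g κ
      go : (Σ Ẑ.M2 λ h → H h × (sgn h ≡ sgn g) × (Ẑ.det h Ẑ.≈ Ẑ.det g)) → R G
      go (h , x , s , δ) = go' (R-inverse Rh)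
        where
        h' = level h κ
        Rh : R h'
        Rh = h , x , ≈-refl
        same-sgn : sgnM G ≡ sgnM h'
        same-sgn = trans (sgn-level g) (trans (sym s) (sym (sgn-level h)))
        same-det : detM h' ≋ detM G [ M ]
        same-det = subst₂ (λ u v → u ≋ v [ M ]) (val-det h κ) (val-det g κ) ⟨ δ κ ⟩
        go' : Inverse h' → R G
        go' ι@(is-inverse Y y _ eˡ) = go'' (full (G · Y) δ' s')
          where
          δ' : detM (G · Y) ≋ 1ℤ [ M ]
          δ' = ≋-trans (≋-reflexive (detM-· G Y)) (≋-trans (*-≋ (≋-sym same-det) ≋-refl) (det-inverse ι))
          s' : sgnM (G · Y) ≡ Sign.+
          s' = trans (sgnM-· (unit-≋ (≋-mono 2∣M same-det) (R-odd Rh)) (R-odd y))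
            (trans (cong₂ Sign._*_ same-sgn (sym (sgn-inverse Rh ι))) (SignP.s*s≡+ (sgnM h')))
          go'' : Near R₁ M (G · Y) → R G
          go'' (Z , z , e) = IsSubgroupMod.resp R-subgroup
            (≈-trans (·-≈ e (≈-refl {h'})) (≈-trans (≈-reflexive (·-assoc G Y h'))
              (≈-trans (·-≈ {G} ≈-refl eˡ) (≈-reflexive (·-identityʳ G)))))
            (IsSubgroupMod.mul R-subgroup (R₁.member z) Rh)

  GL₂⊆H : ∀ g → Ẑ.IsGL2 g → H g
  -- The bound `2 + k` covers the prime factors of `suc k` and keeps the prime 2 in the modulus for
  -- every `k`.
  GL₂⊆H g unit = closed g λ k → approximate k (∣-primorial-power (2 ℕ.+ k) (suc k) (ℕP.n≤1+n (suc k)))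
    where
    approximate : ∀ k → (Σ ℕ λ e → suc k ℕD.∣ primorial (2 ℕ.+ k) ℕ.^ suc e) →
      Σ Ẑ.M2 λ h → H h × (g ≡M h [mod-suc k ])
    approximate k (e , k∣) = go (ℕ.pred N) (sym (ℕP.suc-pred N {{ℕP.m^n≢0 (primorial (2 ℕ.+ k)) (suc e) {{primorial-nonZero (2 ℕ.+ k)}}}}))
      where
      N : ℕ
      N = primorial (2 ℕ.+ k) ℕ.^ suc e
      go : ∀ κ → N ≡ suc κ → Σ Ẑ.M2 λ h → H h × (g ≡M h [mod-suc k ])
      go κ N≡ = conclude (R-level (subst Full N≡ (full-primorial e k (subst (N ℕD.∣_) N≡ ℕD.∣-refl))) g unit)
        where
        2∣M : 2 ℕD.∣ suc κ
        2∣M = subst (2 ℕD.∣_) N≡ (ℕD.∣-trans (prime-∣-primorial (2 ℕ.+ k) prime[2] (ℕP.m≤m+n 2 k)) (ℕD.m∣m*n (primorial (2 ℕ.+ k) ℕ.^ e)))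
        k∣M : suc k ℕD.∣ suc κ
        k∣M = subst (suc k ℕD.∣_) N≡ k∣
        open AtLevel κ 2∣M
        conclude : R (level g κ) → Σ Ẑ.M2 λ h → H h × (g ≡M h [mod-suc k ])
        conclude (h , x , e) = h , x , ≈⇒≡M g h k (≈-trans (≈-sym (level-compat g k κ k∣M))
          (≈-trans (≈-sym (≈-mono k∣M e)) (level-compat h k κ k∣M)))

-- Extending elements of ℤ_ℓ to ℤ̂

^-∣ : ∀ m {i j} → i ℕ.≤ j → m ℕ.^ i ℕD.∣ m ℕ.^ j
^-∣ m {i} {j} i≤j = subst (m ℕ.^ i ℕD.∣_)
  (trans (sym (ℕP.^-distribˡ-+-* m i (j ℕ.∸ i))) (cong (m ℕ.^_) (ℕP.m+[n∸m]≡n i≤j)))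
  (ℕD.m∣m*n (m ℕ.^ (j ℕ.∸ i)))

≋0⇔∣ : + n ≋ 0ℤ [ q ] ⇔ q ℕD.∣ n
≋0⇔∣ {n} {q} = mk⇔ to from
  where
  to : + n ≋ 0ℤ [ q ] → q ℕD.∣ n
  to ⟨ h ⟩ = subst (q ℕD.∣_) (ℕP.+-identityʳ n) (∣⇒∣ᵤ h)
  from : q ℕD.∣ n → + n ≋ 0ℤ [ q ]
  from h = ≋-mono h q≋0

unit-≋0 : UnitMod q (+ n) → ∀ z → + n * z ≋ 0ℤ [ q ] → z ≋ 0ℤ [ q ]
unit-≋0 {n = n} (t ,ᵤ e) z h = lin2 (- z) t e h (lem (+ n) t z)
  where
  lem : ∀ n t z → z - 0ℤ ≡ - z * (n * t - 1ℤ) + t * (n * z - 0ℤ)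
  lem = solve-∀

module _ {ℓ} (ℓ-prime : Prime ℓ) where
  private instance
    ℓ-nonZero : NonZero ℓ
    ℓ-nonZero = prime⇒nonZero ℓ-prime

  ¬unit-∣ : ∀ {n} → UnitMod ℓ (+ n) → ¬ (ℓ ℕD.∣ n)
  ¬unit-∣ {n} (t ,ᵤ e) h = ℕP.<⇒≱ (ℕ.nonTrivial⇒n>1 ℓ {{prime⇒nonTrivial ℓ-prime}}) (ℕD.∣⇒≤ (Equivalence.to ≋0⇔∣
    (≋-trans (≋-sym e) (≋-trans (*-≋ (Equivalence.from ≋0⇔∣ h) ≋-refl) (≋-reflexive (ℤP.*-zeroˡ t))))))

  valuation-≤ : ∀ i j {r} → UnitMod ℓ (+ r) → ℓ ℕ.^ i ℕD.∣ ℓ ℕ.^ j ℕ.* r → i ℕ.≤ j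
  valuation-≤ zero    j       u h = ℕ.z≤n
  valuation-≤ (suc i) zero    {r} u h = contradiction
    (ℕD.∣-trans (ℕD.m∣m*n (ℓ ℕ.^ i)) (subst (ℓ ℕ.^ suc i ℕD.∣_) (ℕP.*-identityˡ r) h)) (¬unit-∣ u)
  valuation-≤ (suc i) (suc j) {r} u h = ℕ.s≤s (valuation-≤ i j u
    (ℕD.*-cancelˡ-∣ ℓ (subst (ℓ ℕ.^ suc i ℕD.∣_) (ℕP.*-assoc ℓ (ℓ ℕ.^ j) r) h)))

  record Split (m : ℕ) : Set where
    field
      valuation : ℕ
      cofactor  : ℕ
      splits    : ℓ ℕ.^ valuation ℕ.* cofactor ≡ m
      coprime   : UnitMod ℓ (+ cofactor)

    cofactor-unit : ∀ v → UnitMod (ℓ ℕ.^ v) (+ cofactor)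
    cofactor-unit v = unit-modulus-^ v coprime

  split : ∀ m → .{{NonZero m}} → Split m
  split = <-rec (λ m → .{{NonZero m}} → Split m) step
    where
    step : ∀ m → (∀ {k} → k ℕ.< m → .{{NonZero k}} → Split k) → .{{NonZero m}} → Split m
    step m rec = go (zero⊎unit ℓ-prime (+ m))
      where
      go : + m ≋ 0ℤ [ ℓ ] ⊎ UnitMod ℓ (+ m) → Split m
      go (inj₂ u) = record { valuation = 0 ; cofactor = m ; splits = ℕP.*-identityˡ m ; coprime = u }
      go (inj₁ h) = go' (Equivalence.to ≋0⇔∣ h)
        where
        go' : ℓ ℕD.∣ m → Split m
        go' ℓ∣m = record { valuation = suc valuation ; cofactor = cofactor ; coprime = coprime
          ; splits = trans (ℕP.*-assoc ℓ (ℓ ℕ.^ valuation) cofactor)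
              (trans (cong (ℓ ℕ.*_) splits) (sym (ℕD.m∣n⇒n≡m*quotient ℓ∣m))) }
          where
          instance
            quotient≢0 : NonZero (ℕD.quotient ℓ∣m)
            quotient≢0 = ℕD.quotient≢0 ℓ∣m
            ℓ-nonTrivial : ℕ.NonTrivial ℓ
            ℓ-nonTrivial = prime⇒nonTrivial ℓ-prime
          open Split (rec (ℕD.quotient-< ℓ∣m))

  -- The element of ℤ̂ = ∏ ℤ_p equal to x at ℓ and to z at every other prime.
  module _ (z : ℤ) (x : Zₗ.El ℓ) where
    private
      module S (k : ℕ) = Split (split (suc k))
      v : ℕ → ℕ
      v = S.valuation
      r : ℕ → ℕ
      r = S.cofactor
      idempotent : ∀ k → UnitMod (ℓ ℕ.^ v k) (+ r k)
      idempotent k = S.cofactor-unit k (v k)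

    -- Chinese remainder interpolation: the coefficient of the difference is an idempotent, 1 modulo
    -- the ℓ-part `ℓ ^ v k` of `suc k` and 0 modulo the cofactor `r k`.
    extension : ℕ → ℤ
    extension k = z + + r k * inverse (idempotent k) * (Zₗ.val x (v k) - z)

    extension-ℓ : ∀ k → extension k ≋ Zₗ.val x (v k) [ ℓ ℕ.^ v k ]
    extension-ℓ k = lin1 (Zₗ.val x (v k) - z) (isInverse (idempotent k))
      (lem z (+ r k * inverse (idempotent k)) (Zₗ.val x (v k)))
      where
      lem : ∀ z e x → z + e * (x - z) - x ≡ (x - z) * (e - 1ℤ)
      lem = solve-∀

    extension-cofactor : ∀ k {n} → n ℕD.∣ r k → extension k ≋ z [ n ]
    extension-cofactor k h = lin1 (inverse (idempotent k) * (Zₗ.val x (v k) - z)) (Equivalence.from ≋0⇔∣ h)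
      (lem z (+ r k) (inverse (idempotent k)) (Zₗ.val x (v k)))
      where
      lem : ∀ z r t x → z + r * t * (x - z) - z ≡ t * (x - z) * (r - 0ℤ)
      lem = solve-∀

    Zₗ-≋ : ∀ {i j} → i ℕ.≤ j → Zₗ.val x j ≋ Zₗ.val x i [ ℓ ℕ.^ i ]
    Zₗ-≋ {i} {j} h = ⟨ Zₗ.compat x i j h ⟩

    extension-ℓ-≤ : ∀ k {i} → ℓ ℕ.^ i ℕD.∣ suc k → extension k ≋ Zₗ.val x i [ ℓ ℕ.^ i ]
    extension-ℓ-≤ k {i} h = ≋-trans (≋-mono (^-∣ ℓ i≤v) (extension-ℓ k)) (Zₗ-≋ i≤v)
      where
      i≤v : i ℕ.≤ v k
      i≤v = valuation-≤ i (v k) (S.coprime k) (subst (ℓ ℕ.^ i ℕD.∣_) (sym (S.splits k)) h)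

  combine-split : ∀ {m} (s : Split m) {x y} → x ≋ y [ ℓ ℕ.^ Split.valuation s ] →
    x ≋ y [ Split.cofactor s ] → x ≋ y [ m ]
  combine-split s {x} {y} h h' = subst (λ m → x ≋ y [ m ]) splits (≋-combine (unit-cop-swap (cofactor-unit valuation)) h' h)
    where open Split s

  -- The cofactor of `m` divides `n`, and the power of ℓ in `n` can be cancelled because it is a
  -- unit modulo that cofactor.
  cofactor-∣ : ∀ {m n} (s : Split m) (t : Split n) → m ℕD.∣ n → Split.cofactor s ℕD.∣ Split.cofactor t
  cofactor-∣ {m} {n} s t m∣n = Equivalence.to ≋0⇔∣ (unit-≋0 (unit-cop-swap (S.cofactor-unit T.valuation)) (+ T.cofactor)
    (subst (λ z → z ≋ 0ℤ [ S.cofactor ]) (trans (cong +_ (sym T.splits)) (ℤP.pos-* (ℓ ℕ.^ T.valuation) T.cofactor))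
      (Equivalence.from ≋0⇔∣ (ℕD.∣-trans (ℕD.divides (ℓ ℕ.^ S.valuation) (sym S.splits)) m∣n))))
    where
    module S = Split s
    module T = Split t

  extend : ℤ → Zₗ.El ℓ → Ẑ.El
  extend z x = record { val = extension z x ; compat = λ i j h → by (compatible i j h) }
    where
    compatible : ∀ i j → suc i ℕD.∣ suc j → extension z x j ≋ extension z x i [ suc i ]
    compatible i j h = combine-split s
      (≋-trans (extension-ℓ-≤ z x j (ℕD.∣-trans (ℕD.divides S.cofactor (trans (sym S.splits) (ℕP.*-comm (ℓ ℕ.^ S.valuation) S.cofactor))) h))
        (≋-sym (extension-ℓ z x i)))
      (≋-trans (extension-cofactor z x j (cofactor-∣ s (split (suc j)) h)) (≋-sym (extension-cofactor z x i ℕD.∣-refl)))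
      where
      s : Split (suc i)
      s = split (suc i)
      module S = Split s

  πₗ-extend : ∀ z x → Zₗ._≈_ ℓ (πₗ ℓ ℓ-prime (extend z x)) x
  πₗ-extend z x n = by (extension-ℓ-≤ z x (ℕ.pred (ℓ ℕ.^ n))
    (subst (ℓ ℕ.^ n ℕD.∣_) (sym (ℕP.suc-pred (ℓ ℕ.^ n) {{ℕP.m^n≢0 ℓ n}})) ℕD.∣-refl))

  -- The default values 1, 0, 0, 1 make the matrix the identity at every prime other than ℓ, hence
  -- invertible there.
  extendM : Zₗ.M2 ℓ → Ẑ.M2
  extendM g = Ẑ.mat (extend 1ℤ (Zₗ.a g)) (extend 0ℤ (Zₗ.b g)) (extend 0ℤ (Zₗ.c g)) (extend 1ℤ (Zₗ.d g))

  extendM-GL2 : ∀ g → Zₗ.IsGL2 ℓ g → Ẑ.IsGL2 (extendM g)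
  extendM-GL2 g (y , e) = extend 1ℤ y , λ k → by (combine-split (split (suc k))
    (≋-trans (product-≋ (extension-ℓ 1ℤ (Zₗ.a g) k) (extension-ℓ 0ℤ (Zₗ.b g) k)
       (extension-ℓ 0ℤ (Zₗ.c g) k) (extension-ℓ 1ℤ (Zₗ.d g) k) (extension-ℓ 1ℤ y k))
       ⟨ e (Split.valuation (split (suc k))) ⟩)
    (product-≋ (extension-cofactor 1ℤ (Zₗ.a g) k ℕD.∣-refl) (extension-cofactor 0ℤ (Zₗ.b g) k ℕD.∣-refl)
       (extension-cofactor 0ℤ (Zₗ.c g) k ℕD.∣-refl) (extension-cofactor 1ℤ (Zₗ.d g) k ℕD.∣-refl)
       (extension-cofactor 1ℤ y k ℕD.∣-refl)))
    where
    product-≋ : ∀ {a b c d y a' b' c' d' y'} → a ≋ a' [ q ] → b ≋ b' [ q ] → c ≋ c' [ q ] → d ≋ d' [ q ] → y ≋ y' [ q ] →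
      (a * d + b * c * - 1ℤ) * y ≋ (a' * d' + b' * c' * - 1ℤ) * y' [ q ]
    product-≋ ha hb hc hd hy = *-≋ (+-≋ (*-≋ ha hd) (*-≋ (*-≋ hb hc) ≋-refl)) hy

-- Necessity of the two conditions

module _ {H : Ẑ.M2 → Set} (everything : IsEverything H) where

  conditionI : ConditionI H
  conditionI ℓ ℓ-prime g unit = extendM ℓ-prime g , proj₂ (everything (extendM ℓ-prime g)) (extendM-GL2 ℓ-prime g unit) ,
    πₗ-extend ℓ-prime 1ℤ (Zₗ.a g) , πₗ-extend ℓ-prime 0ℤ (Zₗ.b g) , πₗ-extend ℓ-prime 0ℤ (Zₗ.c g) , πₗ-extend ℓ-prime 1ℤ (Zₗ.d g)

  conditionII : ConditionII H
  conditionII s u (t , e) = go s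
    where
    u-odd : Ẑ.val u 1 ≋ 1ℤ [ 2 ]
    u-odd = subst (λ b → Ẑ.val u 1 ≋ fromBit b [ 2 ]) (unit⇒odd {Ẑ.val u 1} (Ẑ.val t 1 ,ᵤ ⟨ e 1 ⟩)) (≋-parity (Ẑ.val u 1))
    construct : ∀ g {s} Y → (∀ k → Ẑ.val (Ẑ.det g) k ≡ Ẑ.val u k) → level g 1 ≈ Y [ 2 ] → sgnM Y ≡ s →
      Σ Ẑ.M2 λ h → H h × (sgn h ≡ s) × (Ẑ.det h Ẑ.≈ u)
    construct g Y δ f σ = g ,
      proj₂ (everything g) (t , λ k → by (≋-trans (*-≋ (≋-reflexive (δ k)) ≋-refl) ⟨ e k ⟩)) ,
      trans (sgn-level-1 g) (trans (sgnM-≈ f) σ) , λ k → by (≋-reflexive (δ k))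
    go : ∀ s → Σ Ẑ.M2 λ h → H h × (sgn h ≡ s) × (Ẑ.det h Ẑ.≈ u)
    -- A unit of ℤ̂ is odd, so diag(u, 1) reduces to the identity modulo 2.
    go Sign.+ = construct (Ẑ.mat u Ẑ.zro Ẑ.zro Ẑ.one) 𝟙 (λ k → lem (Ẑ.val u k))
      (entrywise u-odd ≋-refl ≋-refl ≋-refl) refl
      where
      lem : ∀ u → u * 1ℤ + 0ℤ * 0ℤ * - 1ℤ ≡ u
      lem = solve-∀
    -- Modulo 2 this matrix exchanges the two basis vectors and fixes their sum, a transposition;
    -- the entry -u makes the determinant u.
    go Sign.- = construct (Ẑ.mat Ẑ.zro Ẑ.one (Ẑ.⊖ u) Ẑ.zro) (mk 0ℤ 1ℤ 1ℤ 0ℤ) (λ k → lem (Ẑ.val u k))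
      (entrywise ≋-refl ≋-refl (≋-trans (*-≋ u-odd ≋-refl) (lin0 (- 1ℤ) refl)) ≋-refl) refl
      where
      lem : ∀ u → 0ℤ * 0ℤ + 1ℤ * (u * - 1ℤ) * - 1ℤ ≡ u
      lem = solve-∀

theorem1p1 : (H : Ẑ.M2 → Set) → IsClosedSubgroup H →
    (IsEverything H ⇔ (ConditionI H × ConditionII H))
theorem1p1 H closed-subgroup = mk⇔
  (λ everything → conditionI everything , conditionII everything)
  (λ (i , ii) g → IsClosedSubgroup.⊆GL2 closed-subgroup g , GL₂⊆H closed-subgroup i ii g)
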